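{- Let $q$ be a prime with $q \equiv 3 \pmod 4$, and let $C_1 > \sqrt[4]{2}$. Suppose $E \subset \mathbb{F}_q^2$ satisfies $|E| > C_1 q^{7/4}$. Then there exists $C_2 > 0$ depending only on $C_1$ such that $|T_2(E)| \ge C_2 q^3$, where $T_2(E)$ is the set of congruence classes of triangles determined by $E$.
   Context: For $x=(x_1,x_2), y=(y_1,y_2) \in \mathbb{F}_q^2$ the "distance" is $\|x-y\| = (x_1-y_1)^2+(x_2-y_2)^2 \in \mathbb{F}_q$. A triangle determined by $E$ is a triple $(x^1,x^2,x^3)$ of points of $E$. Two triples $(x^1,x^2,x^3)$ and $(y^1,y^2,y^3)$ of points of $\mathbb{F}_q^2$ are congruent if there exist $\theta \in O_2(\mathbb{F}_q)$ (the group of $2\times 2$ matrices $A$ over $\mathbb{F}_q$ with $A^TA=I$) and $\tau \in \mathbb{F}_q^2$ such that $y^j = \theta x^j + \tau$ for $j=1,2,3$. $T_2(E)$ is the set of congruence classes (among all triples in $\mathbb{F}_q^2$) containing at least one triangle with vertices in $E$. -}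

module Defs where

open import Data.Fin.Base using (Fin; toℕ)
import Data.Fin.Properties as Fin
open import Data.Integer.Base as ℤ using (+_)
import Data.Integer.Properties as ℤ
open import Data.List.Base using (List; length; filter; deduplicate; allFin; cartesianProduct)
open import Data.Nat.Base as ℕ using (ℕ; zero; suc)
import Data.Nat.Properties as ℕ
open import Data.Nat.DivMod using (_mod_)
open import Data.Product.Base using (_×_; _,_; proj₁; proj₂; ∃; ∃-syntax)
open import Data.Product.Properties using (≡-dec)
open import Data.Rational.Base
import Data.Rational.Unnormalised.Base as ℚᵘ
import Data.Rational.Unnormalised.Properties as ℚᵘ
open import Data.Rational.Properties
open import Data.Rational.Solver using (module +-*-Solver)
open import Data.Sum.Base using (_⊎_; inj₁; inj₂)
open import Level using (0ℓ)
open import Relation.Binary.Definitions using (DecidableEquality)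
open import Relation.Binary.PropositionalEquality using (_≡_; refl; sym; trans; cong; cong₂; subst; subst₂)
open import Relation.Nullary.Decidable using (Dec; yes; no; map′; _×-dec_)
open import Relation.Nullary.Negation using (¬_; contradiction)
open import Relation.Unary using (Pred; Decidable)

open +-*-Solver using (solve; con; _:=_; _:+_; _:*_; _:-_; :-_)

------------------------------------------------------------------------
-- Real numbers as two-sided (located) Dedekind cuts of rationals:
-- L p means "p < x" and U p means "x < p".

record ℝ : Set₁ where
  field
    L U        : ℚ → Set
    L-inhab    : ∃ L
    U-inhab    : ∃ U
    L-closed   : ∀ {p r} → p < r → L r → L p
    L-rounded  : ∀ {p} → L p → ∃[ r ] (p < r × L r)
    U-closed   : ∀ {p r} → r < p → U r → U p
    U-rounded  : ∀ {p} → U p → ∃[ r ] (r < p × U r)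
    disjoint   : ∀ {p} → L p → ¬ U p
    located    : ∀ {p r} → p < r → L p ⊎ U r

  L<U : ∀ {p r} → L p → U r → p < r
  L<U {p} {r} Lp Ur with p <? r
  ... | yes p<r = p<r
  ... | no p≮r with ≮⇒≥ p≮r
  ...   | r≤p with r ≟ p
  ...     | yes refl = contradiction Ur (disjoint Lp)
  ...     | no r≢p   = contradiction (U-closed (≤∧≢⇒< r≤p r≢p) Ur) (disjoint Lp)
    where
    ≤∧≢⇒< : ∀ {s t} → s ≤ t → ¬ s ≡ t → s < t
    ≤∧≢⇒< s≤t s≢t = ≰⇒> λ t≤s → s≢t (≤-antisym s≤t t≤s)

infix 4 _<ʳ_ _>ʳ_ _≤ʳ_ _≥ʳ_

_<ʳ_ _>ʳ_ _≤ʳ_ _≥ʳ_ : ℝ → ℝ → Set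
x <ʳ y = ∃[ p ] (ℝ.U x p × ℝ.L y p)
x >ʳ y = y <ʳ x
x ≤ʳ y = ∀ p → ℝ.L x p → ℝ.L y p
x ≥ʳ y = y ≤ʳ x

------------------------------------------------------------------------
-- Auxiliary facts about ℚ

private
  p-1<p : ∀ p → p - 1ℚ < p
  p-1<p p = subst (p - 1ℚ <_) (+-identityʳ p) (+-monoʳ-< p {x = - 1ℚ} {y = 0ℚ} (negative⁻¹ (- 1ℚ)))

  p<p+1 : ∀ p → p < p + 1ℚ
  p<p+1 p = subst (_< p + 1ℚ) (+-identityʳ p) (+-monoʳ-< p {x = 0ℚ} {y = 1ℚ} (positive⁻¹ 1ℚ))

  p<p+ε : ∀ p {ε} → 0ℚ < ε → p < p + ε
  p<p+ε p {ε} 0<ε = subst (_< p + ε) (+-identityʳ p) (+-monoʳ-< p 0<ε)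

  0<r-p : ∀ {p r} → p < r → 0ℚ < r - p
  0<r-p {p} {r} p<r = subst (_< r - p) (+-inverseʳ p) (+-monoˡ-< (- p) p<r)

fromℕ : ℕ → ℚ
fromℕ n = + n / 1

infixl 8 _⁴

_⁴ : ℚ → ℚ
p ⁴ = (p * p) * (p * p)

------------------------------------------------------------------------
-- Embedding of ℚ and ℕ

ratʳ : ℚ → ℝ
ratʳ x = record
  { L         = λ p → p < x
  ; U         = λ p → x < p
  ; L-inhab   = x - 1ℚ , p-1<p x
  ; U-inhab   = x + 1ℚ , p<p+1 x
  ; L-closed  = <-trans
  ; L-rounded = <-dense
  ; U-closed  = λ r<p x<r → <-trans x<r r<p
  ; U-rounded = λ x<p → let m , x<m , m<p = <-dense x<p in m , m<p , x<m
  ; disjoint  = <-asym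
  ; located   = λ {p} {r} p<r → loc p<r
  }
  where
  loc : ∀ {p r} → p < r → p < x ⊎ x < r
  loc {p} {r} p<r with p <? x
  ... | yes p<x = inj₁ p<x
  ... | no  p≮x = inj₂ (≤-<-trans (≮⇒≥ p≮x) p<r)

natʳ : ℕ → ℝ
natʳ n = ratʳ (fromℕ n)

------------------------------------------------------------------------
-- The non-negative fourth root of a natural number: p < ∜ n iff some
-- rational r > p satisfies 0 ≤ r and r⁴ ≤ n, and dually.

private
  *-mono-≤-nonNeg : ∀ {a b c d} → 0ℚ ≤ a → 0ℚ ≤ d → a ≤ b → c ≤ d → a * c ≤ b * d
  *-mono-≤-nonNeg {a} {b} {c} {d} 0≤a 0≤d a≤b c≤d =
    ≤-trans (*-monoˡ-≤-nonNeg a {{nonNegative 0≤a}} c≤d)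
            (*-monoʳ-≤-nonNeg d {{nonNegative 0≤d}} a≤b)

  *-mono-<-nonNeg : ∀ {a b} → 0ℚ ≤ a → a < b → a * a < b * b
  *-mono-<-nonNeg {a} {b} 0≤a a<b =
    ≤-<-trans (*-monoˡ-≤-nonNeg a {{nonNegative 0≤a}} (<⇒≤ a<b))
              (*-monoˡ-<-pos b {{positive (≤-<-trans 0≤a a<b)}} a<b)

  0≤a*a : ∀ {a} → 0ℚ ≤ a → 0ℚ ≤ a * a
  0≤a*a {a} 0≤a = subst (_≤ a * a) (*-zeroʳ a) (*-monoˡ-≤-nonNeg a {{nonNegative 0≤a}} 0≤a)

⁴-mono-< : ∀ {a b} → 0ℚ ≤ a → a < b → a ⁴ < b ⁴
⁴-mono-< 0≤a a<b = *-mono-<-nonNeg (0≤a*a 0≤a) (*-mono-<-nonNeg 0≤a a<b)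

private
  0≤fromℕ : ∀ n → 0ℚ ≤ fromℕ n
  0≤fromℕ n = nonNegative⁻¹ (fromℕ n) {{normalize-nonNeg n 1}}

  1≤a*a : ∀ {a} → 1ℚ ≤ a → a ≤ a * a
  1≤a*a {a} 1≤a = subst (_≤ a * a) (*-identityʳ a)
    (*-monoˡ-≤-nonNeg a {{nonNegative (≤-trans (nonNegative⁻¹ 1ℚ) 1≤a)}} 1≤a)

  t≤t⁴ : ∀ {a} → 1ℚ ≤ a → a ≤ a ⁴
  t≤t⁴ 1≤a = ≤-trans (1≤a*a 1≤a) (1≤a*a (≤-trans 1≤a (1≤a*a 1≤a)))

∜ : ℕ → ℝ
∜ n = record
  { L         = λ p → ∃[ r ] (0ℚ ≤ r × p < r × r ⁴ ≤ fromℕ n)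
  ; U         = λ p → ∃[ r ] (0ℚ ≤ r × r < p × fromℕ n ≤ r ⁴)
  ; L-inhab   = 0ℚ - 1ℚ , 0ℚ , ≤-refl , p-1<p 0ℚ , 0≤fromℕ n
  ; U-inhab   = t + 1ℚ , t , ≤-trans (nonNegative⁻¹ 1ℚ) 1≤t , p<p+1 t , ≤-trans n≤t (t≤t⁴ 1≤t)
  ; L-closed  = λ { p<p′ (r , 0≤r , p′<r , r⁴≤n) → r , 0≤r , <-trans p<p′ p′<r , r⁴≤n }
  ; L-rounded = λ { (r , 0≤r , p<r , r⁴≤n) →
      let m , p<m , m<r = <-dense p<r in m , p<m , r , 0≤r , m<r , r⁴≤n }
  ; U-closed  = λ { p′<p (r , 0≤r , r<p′ , n≤r⁴) → r , 0≤r , <-trans r<p′ p′<p , n≤r⁴ }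
  ; U-rounded = λ { (r , 0≤r , r<p , n≤r⁴) →
      let m , r<m , m<p = <-dense r<p in m , m<p , r , 0≤r , r<m , n≤r⁴ }
  ; disjoint  = λ { (r , 0≤r , p<r , r⁴≤n) (s , 0≤s , s<p , n≤s⁴) →
      <-irrefl refl (<-≤-trans (⁴-mono-< 0≤s (<-trans s<p p<r)) (≤-trans r⁴≤n n≤s⁴)) }
  ; located   = λ {p} {r} p<r → loc p<r
  }
  where
  t : ℚ
  t = fromℕ n + 1ℚ

  n≤t : fromℕ n ≤ t
  n≤t = <⇒≤ (p<p+1 (fromℕ n))

  1≤t : 1ℚ ≤ t
  1≤t = subst (_≤ t) (+-identityˡ 1ℚ) (+-monoˡ-≤ 1ℚ (0≤fromℕ n))

  loc : ∀ {p r} → p < r → (∃[ s ] (0ℚ ≤ s × p < s × s ⁴ ≤ fromℕ n))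
                        ⊎ (∃[ s ] (0ℚ ≤ s × s < r × fromℕ n ≤ s ⁴))
  loc p<r with <-dense p<r
  ... | m , p<m , m<r with 0ℚ ≤? m
  ...   | no  0≰m = inj₁ (0ℚ , ≤-refl , <-trans p<m (≰⇒> 0≰m) , 0≤fromℕ n)
  ...   | yes 0≤m with ≤-total (m ⁴) (fromℕ n)
  ...     | inj₁ m⁴≤n = inj₁ (m , 0≤m , p<m , m⁴≤n)
  ...     | inj₂ n≤m⁴ = inj₂ (m , 0≤m , m<r , n≤m⁴)

------------------------------------------------------------------------
-- Multiplication, by interval arithmetic: p < x y iff p lies below all
-- four endpoint products of some rational intervals [a , b] ∋ x and
-- [c , d] ∋ y.

private
  Lᵐ Uᵐ : ℝ → ℝ → ℚ → Set
  Lᵐ x y p = ∃[ a ] ∃[ b ] ∃[ c ] ∃[ d ]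
    ((ℝ.L x a × ℝ.U x b × ℝ.L y c × ℝ.U y d) ×
     (p < a * c × p < a * d × p < b * c × p < b * d))
  Uᵐ x y p = ∃[ a ] ∃[ b ] ∃[ c ] ∃[ d ]
    ((ℝ.L x a × ℝ.U x b × ℝ.L y c × ℝ.U y d) ×
     (a * c < p × a * d < p × b * c < p × b * d < p))

  linear-lower : ∀ {a b} z {x p} → a ≤ x → x ≤ b → p < a * z → p < b * z → p < x * z
  linear-lower z a≤x x≤b p<az p<bz with ≤-total 0ℚ z
  ... | inj₁ 0≤z = <-≤-trans p<az (*-monoʳ-≤-nonNeg z {{nonNegative 0≤z}} a≤x)
  ... | inj₂ z≤0 = <-≤-trans p<bz (*-monoʳ-≤-nonPos z {{nonPositive z≤0}} x≤b)

  linear-upper : ∀ {a b} z {x p} → a ≤ x → x ≤ b → a * z < p → b * z < p → x * z < p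
  linear-upper z a≤x x≤b az<p bz<p with ≤-total 0ℚ z
  ... | inj₁ 0≤z = ≤-<-trans (*-monoʳ-≤-nonNeg z {{nonNegative 0≤z}} x≤b) bz<p
  ... | inj₂ z≤0 = ≤-<-trans (*-monoʳ-≤-nonPos z {{nonPositive z≤0}} a≤x) az<p

  flip-< : ∀ {p} a b → p < a * b → p < b * a
  flip-< {p} a b = subst (p <_) (*-comm a b)

  flip-> : ∀ {p} a b → a * b < p → b * a < p
  flip-> {p} a b = subst (_< p) (*-comm a b)

bilinear-lower : ∀ {a b c d x y p} → a ≤ x → x ≤ b → c ≤ y → y ≤ d →
  p < a * c × p < a * d × p < b * c × p < b * d → p < x * y
bilinear-lower {a} {b} {c} {d} {x} {y} a≤x x≤b c≤y y≤d (ac , ad , bc , bd) =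
  linear-lower y a≤x x≤b
    (flip-< y a (linear-lower a c≤y y≤d (flip-< a c ac) (flip-< a d ad)))
    (flip-< y b (linear-lower b c≤y y≤d (flip-< b c bc) (flip-< b d bd)))

bilinear-upper : ∀ {a b c d x y p} → a ≤ x → x ≤ b → c ≤ y → y ≤ d →
  a * c < p × a * d < p × b * c < p × b * d < p → x * y < p
bilinear-upper {a} {b} {c} {d} {x} {y} a≤x x≤b c≤y y≤d (ac , ad , bc , bd) =
  linear-upper y a≤x x≤b
    (flip-> y a (linear-upper a c≤y y≤d (flip-> a c ac) (flip-> a d ad)))
    (flip-> y b (linear-upper b c≤y y≤d (flip-> b c bc) (flip-> b d bd)))

private
  step : ℚ → ℕ → ℚ → ℚ
  step δ zero    a = a
  step δ (suc n) a = step δ n (a + δ)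

  fromℕ-suc : ∀ n → fromℕ (suc n) ≡ 1ℚ + fromℕ n
  fromℕ-suc n = toℚᵘ-injective (begin-equality
    toℚᵘ (fromℕ (suc n))             ≃⟨ toℚᵘ-fromℚᵘ (ℚᵘ.mkℚᵘ (+ suc n) 0) ⟩
    ℚᵘ.mkℚᵘ (+ suc n) 0              ≃⟨ ℚᵘ.*≡* (cong (λ m → (+ 1 ℤ.+ m) ℤ.* + 1) (sym (ℤ.*-identityʳ (+ n)))) ⟩
    ℚᵘ.mkℚᵘ (+ 1) 0 ℚᵘ.+ ℚᵘ.mkℚᵘ (+ n) 0
      ≃⟨ ℚᵘ.+-congʳ (ℚᵘ.mkℚᵘ (+ 1) 0) (toℚᵘ-fromℚᵘ (ℚᵘ.mkℚᵘ (+ n) 0)) ⟨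
    toℚᵘ 1ℚ ℚᵘ.+ toℚᵘ (fromℕ n)      ≃⟨ toℚᵘ-homo-+ 1ℚ (fromℕ n) ⟨
    toℚᵘ (1ℚ + fromℕ n)              ∎)
    where open ℚᵘ.≤-Reasoning

  archimedean : ∀ t → ∃[ n ] t < fromℕ n
  archimedean t@(mkℚ i d-1 _) = n , toℚᵘ-cancel-< (begin-strict
    toℚᵘ t               <⟨ ℚᵘ.*<* i*1<n*d ⟩
    ℚᵘ.mkℚᵘ (+ n) 0      ≃⟨ toℚᵘ-fromℚᵘ (ℚᵘ.mkℚᵘ (+ n) 0) ⟨
    toℚᵘ (fromℕ n)       ∎)
    where
    open ℚᵘ.≤-Reasoning
    n = suc ℤ.∣ i ∣

    i≤∣i∣ : ∀ j → j ℤ.≤ + ℤ.∣ j ∣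
    i≤∣i∣ (+ _)       = ℤ.≤-refl
    i≤∣i∣ ℤ.-[1+ _ ] = ℤ.-≤+

    i*1<n*d : i ℤ.* + 1 ℤ.< + n ℤ.* + suc d-1
    i*1<n*d = subst (ℤ._< + n ℤ.* + suc d-1) (sym (ℤ.*-identityʳ i))
      (ℤ.≤-<-trans (i≤∣i∣ i) (ℤ.+<+ (ℕ.m≤m*n n (suc d-1))))

  step-fromℕ : ∀ δ n a → step δ n a ≡ a + fromℕ n * δ
  step-fromℕ δ zero    a = sym (trans (cong (λ z → a + z) (*-zeroˡ δ)) (+-identityʳ a))
  step-fromℕ δ (suc n) a = trans (step-fromℕ δ n (a + δ))
    (trans (solve 3 (λ a δ n → (a :+ δ) :+ n :* δ := a :+ (con 1ℚ :+ n) :* δ) refl a δ (fromℕ n))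
           (cong (λ m → a + m * δ) (sym (fromℕ-suc n))))

  archimedean-step : ∀ {δ} → 0ℚ < δ → ∀ a b → ∃[ n ] b < step δ n a
  archimedean-step {δ} 0<δ a b = n , subst₂ _<_ b-a+a (sym (step-fromℕ δ n a)) (+-monoʳ-< a t*δ<n*δ)
    where
    instance
      δ-pos = positive 0<δ
      δ≢0   = pos⇒nonZero δ
    t = (b - a) * 1/ δ
    n = proj₁ (archimedean t)
    t*δ≡b-a : t * δ ≡ b - a
    t*δ≡b-a = trans (*-assoc (b - a) (1/ δ) δ)
      (trans (cong ((b - a) *_) (*-inverseˡ δ)) (*-identityʳ (b - a)))
    t*δ<n*δ : b - a < fromℕ n * δ
    t*δ<n*δ = subst (_< fromℕ n * δ) t*δ≡b-a (*-monoˡ-<-pos δ (proj₂ (archimedean t)))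
    b-a+a : a + (b - a) ≡ b
    b-a+a = solve 2 (λ a b → a :+ (b :- a) := b) refl a b

  walk : ∀ x {δ} → 0ℚ < δ → ∀ n a → ℝ.L x a → ℝ.U x (step δ n a) →
    ∃[ a′ ] (a ≤ a′ × ℝ.L x a′ × ℝ.U x (a′ + δ + δ))
  walk x 0<δ zero    a La Ua = contradiction Ua (ℝ.disjoint x La)
  walk x {δ} 0<δ (suc n) a La Us with ℝ.located x (p<p+ε (a + δ) 0<δ)
  ... | inj₂ U′ = a , ≤-refl , La , U′
  ... | inj₁ L′ with walk x 0<δ n (a + δ) L′ Us
  ...   | a′ , a+δ≤a′ , La′ , Ua′ = a′ , ≤-trans (<⇒≤ (p<p+ε a 0<δ)) a+δ≤a′ , La′ , Ua′

  L-⊔ : ∀ x {s t} → ℝ.L x s → ℝ.L x t → ℝ.L x (s ⊔ t)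
  L-⊔ x {s} {t} Ls Lt with s ⊔ t | ⊔-sel s t
  ... | _ | inj₁ refl = Ls
  ... | _ | inj₂ refl = Lt

  meet : ∀ x {s t} → ℝ.U x s → ℝ.U x t → ∃[ r ] (ℝ.U x r × r ≤ s × r ≤ t)
  meet x {s} {t} Us Ut with ≤-total s t
  ... | inj₁ s≤t = s , Us , ≤-refl , s≤t
  ... | inj₂ t≤s = t , Ut , t≤s , ≤-refl

  bracket : ∀ x {δ} → 0ℚ < δ → ∀ {a₀ b₀} → ℝ.L x a₀ → ℝ.U x b₀ →
    ∃[ a ] ∃[ b ] (ℝ.L x a × ℝ.U x b × a₀ ≤ a × b ≤ b₀ × b ≤ a + δ + δ)
  bracket x {δ} 0<δ {a₀} {b₀} La₀ Ub₀ =
    let n , b₀<s = archimedean-step 0<δ a₀ b₀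
        a , a₀≤a , La , Ua = walk x 0<δ n a₀ La₀ (ℝ.U-closed x b₀<s Ub₀)
        b , Ub , b≤a+2δ , b≤b₀ = meet x Ua Ub₀
    in a , b , La , Ub , a₀≤a , b≤b₀ , b≤a+2δ

  ∣p∣≤ : ∀ {p m} → p ≤ m → - p ≤ m → ∣ p ∣ ≤ m
  ∣p∣≤ {p} {m} p≤m -p≤m with ∣p∣≡p∨∣p∣≡-p p
  ... | inj₁ eq = subst (_≤ m) (sym eq) p≤m
  ... | inj₂ eq = subst (_≤ m) (sym eq) -p≤m

  p≤∣p∣ : ∀ p → p ≤ ∣ p ∣
  p≤∣p∣ p with ≤-total 0ℚ p
  ... | inj₁ 0≤p = ≤-reflexive (sym (0≤p⇒∣p∣≡p 0≤p))
  ... | inj₂ p≤0 = ≤-trans p≤0 (0≤∣p∣ p)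

  -p≤∣p∣ : ∀ p → - p ≤ ∣ p ∣
  -p≤∣p∣ p = subst (- p ≤_) (∣-p∣≡∣p∣ p) (p≤∣p∣ (- p))

  ∣between∣ : ∀ {a₀ b₀ p} → a₀ ≤ p → p ≤ b₀ → ∣ p ∣ ≤ ∣ a₀ ∣ + ∣ b₀ ∣
  ∣between∣ {a₀} {b₀} {p} a₀≤p p≤b₀ = ∣p∣≤
    (≤-trans p≤b₀ (subst (_≤ ∣ a₀ ∣ + ∣ b₀ ∣) (+-identityˡ b₀) (+-mono-≤ (0≤∣p∣ a₀) (p≤∣p∣ b₀))))
    (≤-trans (neg-antimono-≤ a₀≤p)
      (subst (_≤ ∣ a₀ ∣ + ∣ b₀ ∣) (+-identityʳ (- a₀)) (+-mono-≤ (-p≤∣p∣ a₀) (0≤∣p∣ b₀))))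

  -- |st − ac| ≤ |s − a||t| + |a||t − c|.
  product-close : ∀ {a c s t M δ} → 0ℚ ≤ M → 0ℚ ≤ δ → ∣ a ∣ ≤ M → ∣ t ∣ ≤ M →
    ∣ s - a ∣ ≤ δ → ∣ t - c ∣ ≤ δ → ∣ s * t - a * c ∣ ≤ M * δ + M * δ
  product-close {a} {c} {s} {t} {M} {δ} 0≤M 0≤δ a≤M t≤M s-a≤δ t-c≤δ = begin
    ∣ s * t - a * c ∣                      ≡⟨ cong ∣_∣ (solve 4 (λ a c s t →
      s :* t :- a :* c := t :* (s :- a) :+ a :* (t :- c)) refl a c s t) ⟩
    ∣ t * (s - a) + a * (t - c) ∣          ≤⟨ ∣p+q∣≤∣p∣+∣q∣ (t * (s - a)) (a * (t - c)) ⟩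
    ∣ t * (s - a) ∣ + ∣ a * (t - c) ∣      ≡⟨ cong₂ _+_ (∣p*q∣≡∣p∣*∣q∣ t (s - a)) (∣p*q∣≡∣p∣*∣q∣ a (t - c)) ⟩
    ∣ t ∣ * ∣ s - a ∣ + ∣ a ∣ * ∣ t - c ∣  ≤⟨ +-mono-≤
      (*-mono-≤-nonNeg (0≤∣p∣ t) 0≤δ t≤M s-a≤δ) (*-mono-≤-nonNeg (0≤∣p∣ a) 0≤δ a≤M t-c≤δ) ⟩
    M * δ + M * δ                          ∎
    where open ≤-Reasoning

  -- Choose δ so small that all four endpoint products of brackets of
  -- width at most 2δ lie within η of a c.
  fine : ∀ x y {η} → 0ℚ < η → ∃[ a ] ∃[ b ] ∃[ c ] ∃[ d ]
    ((ℝ.L x a × ℝ.U x b × ℝ.L y c × ℝ.U y d) ×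
     (∣ a * c - a * c ∣ < η × ∣ a * d - a * c ∣ < η × ∣ b * c - a * c ∣ < η × ∣ b * d - a * c ∣ < η))
  fine x y {η} 0<η = a , b , c , d , (La , Ub , Lc , Ud) ,
    close a c a≤M c≤M a-a≤2δ c-c≤2δ , close a d a≤M d≤M a-a≤2δ d-c≤2δ ,
    close b c a≤M c≤M b-a≤2δ c-c≤2δ , close b d a≤M d≤M b-a≤2δ d-c≤2δ
    where
    module X = ℝ x
    module Y = ℝ y
    a₀ = proj₁ X.L-inhab
    b₀ = proj₁ X.U-inhab
    c₀ = proj₁ Y.L-inhab
    d₀ = proj₁ Y.U-inhab
    Mx = ∣ a₀ ∣ + ∣ b₀ ∣
    My = ∣ c₀ ∣ + ∣ d₀ ∣
    M  = Mx + My
    0≤+ : ∀ {p r} → 0ℚ ≤ p → 0ℚ ≤ r → 0ℚ ≤ p + r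
    0≤+ {p} {r} 0≤p 0≤r = subst (_≤ p + r) (+-identityˡ 0ℚ) (+-mono-≤ 0≤p 0≤r)
    0≤Mx = 0≤+ (0≤∣p∣ a₀) (0≤∣p∣ b₀)
    0≤My = 0≤+ (0≤∣p∣ c₀) (0≤∣p∣ d₀)
    0≤M = 0≤+ 0≤Mx 0≤My
    K = (M + M) + (M + M) + 1ℚ
    K-pos : Positive K
    K-pos = positive (≤-<-trans (0≤+ (0≤+ 0≤M 0≤M) (0≤+ 0≤M 0≤M)) (p<p+1 ((M + M) + (M + M))))
    instance
      _ = K-pos
      _ = pos⇒nonZero K
      _ = 1/pos⇒pos K
      _ = positive 0<η
    δ = η * 1/ K
    0<δ : 0ℚ < δ
    0<δ = subst (_< δ) (*-zeroˡ (1/ K)) (*-monoˡ-<-pos (1/ K) 0<η)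
    0≤2δ : 0ℚ ≤ δ + δ
    0≤2δ = 0≤+ (<⇒≤ 0<δ) (<⇒≤ 0<δ)
    Kδ≡η : K * δ ≡ η
    Kδ≡η = trans (solve 3 (λ k e i → k :* (e :* i) := e :* (k :* i)) refl K η (1/ K))
      (trans (cong (η *_) (*-inverseʳ K)) (*-identityʳ η))
    bound : M * (δ + δ) + M * (δ + δ) < η
    bound = subst₂ _<_
      (solve 2 (λ m e → ((m :+ m) :+ (m :+ m)) :* e := m :* (e :+ e) :+ m :* (e :+ e)) refl M δ)
      Kδ≡η (*-monoˡ-<-pos δ {{positive 0<δ}} (p<p+1 ((M + M) + (M + M))))
    bx = bracket x 0<δ (proj₂ X.L-inhab) (proj₂ X.U-inhab)
    by = bracket y 0<δ (proj₂ Y.L-inhab) (proj₂ Y.U-inhab)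
    a = proj₁ bx
    b = proj₁ (proj₂ bx)
    c = proj₁ by
    d = proj₁ (proj₂ by)
    La = proj₁ (proj₂ (proj₂ bx))
    Ub = proj₁ (proj₂ (proj₂ (proj₂ bx)))
    Lc = proj₁ (proj₂ (proj₂ by))
    Ud = proj₁ (proj₂ (proj₂ (proj₂ by)))
    a₀≤a = proj₁ (proj₂ (proj₂ (proj₂ (proj₂ bx))))
    c₀≤c = proj₁ (proj₂ (proj₂ (proj₂ (proj₂ by))))
    b≤b₀ = proj₁ (proj₂ (proj₂ (proj₂ (proj₂ (proj₂ bx)))))
    d≤d₀ = proj₁ (proj₂ (proj₂ (proj₂ (proj₂ (proj₂ by)))))
    b≤a+2δ = proj₂ (proj₂ (proj₂ (proj₂ (proj₂ (proj₂ bx)))))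
    d≤c+2δ = proj₂ (proj₂ (proj₂ (proj₂ (proj₂ (proj₂ by)))))
    a≤b = <⇒≤ (X.L<U La Ub)
    c≤d = <⇒≤ (Y.L<U Lc Ud)
    Mx≤M = subst (_≤ M) (+-identityʳ Mx) (+-monoʳ-≤ Mx 0≤My)
    My≤M = subst (_≤ M) (+-identityˡ My) (+-monoˡ-≤ My 0≤Mx)
    a≤M = ≤-trans (∣between∣ a₀≤a (≤-trans a≤b b≤b₀)) Mx≤M
    c≤M = ≤-trans (∣between∣ c₀≤c (≤-trans c≤d d≤d₀)) My≤M
    d≤M = ≤-trans (∣between∣ (≤-trans c₀≤c c≤d) d≤d₀) My≤M
    diff : ∀ {p r} → p ≤ r → r ≤ p + δ + δ → ∣ r - p ∣ ≤ δ + δ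
    diff {p} {r} p≤r r≤p+2δ = subst₂ _≤_
      (sym (0≤p⇒∣p∣≡p (subst (_≤ r - p) (+-inverseʳ p) (+-monoˡ-≤ (- p) p≤r))))
      (solve 2 (λ p e → (p :+ e :+ e) :- p := e :+ e) refl p δ)
      (+-monoˡ-≤ (- p) r≤p+2δ)
    self : ∀ p → ∣ p - p ∣ ≤ δ + δ
    self p = subst (λ z → ∣ z ∣ ≤ δ + δ) (sym (+-inverseʳ p)) 0≤2δ
    a-a≤2δ = self a
    c-c≤2δ = self c
    b-a≤2δ = diff a≤b b≤a+2δ
    d-c≤2δ = diff c≤d d≤c+2δ
    close : ∀ s t → ∣ a ∣ ≤ M → ∣ t ∣ ≤ M → ∣ s - a ∣ ≤ δ + δ → ∣ t - c ∣ ≤ δ + δ →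
      ∣ s * t - a * c ∣ < η
    close s t p q r u = ≤-<-trans (product-close {a} {c} {s} {t} 0≤M 0≤2δ p q r u) bound

  above : ∀ {p v m η} → ∣ v - m ∣ < η → p + η ≤ m → p < v
  above {p} {v} {m} {η} close p+η≤m = subst₂ _<_
    (solve 2 (λ p e → (p :+ e) :- e := p) refl p η)
    (solve 2 (λ m v → (m :+ (v :- m)) := v) refl m v)
    (+-mono-≤-< p+η≤m (subst (- η <_) (solve 1 (λ z → :- (:- z) := z) refl (v - m))
      (neg-antimono-< (≤-<-trans (-p≤∣p∣ (v - m)) close))))

  below : ∀ {r v m η} → ∣ v - m ∣ < η → m ≤ r - η → v < r
  below {r} {v} {m} {η} close m≤r-η = subst₂ _<_
    (solve 2 (λ m v → (m :+ (v :- m)) := v) refl m v)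
    (solve 2 (λ r e → (r :- e) :+ e := r) refl r η)
    (+-mono-≤-< m≤r-η (≤-<-trans (p≤∣p∣ (v - m)) close))

  locᵐ : ∀ x y {p r} → p < r → Lᵐ x y p ⊎ Uᵐ x y r
  locᵐ x y {p} {r} p<r with <-dense (0<r-p p<r)
  ... | e , 0<e , e<r-p = go (fine x y 0<η)
    where
    η = e * ½
    0<η : 0ℚ < η
    0<η = subst (_< η) (*-zeroˡ ½) (*-monoˡ-<-pos ½ 0<e)
    p+η≤r-η : p + η ≤ r - η
    p+η≤r-η = <⇒≤ (subst₂ _<_
      (solve 2 (λ p e → (p :+ e) :- e :* con ½ := p :+ e :* con ½) refl p e)
      (solve 3 (λ p r e → (p :+ (r :- p)) :- e :* con ½ := r :- e :* con ½) refl p r e)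
      (+-monoˡ-< (- η) (+-monoʳ-< p e<r-p)))
    go : (∃[ a ] ∃[ b ] ∃[ c ] ∃[ d ]
      ((ℝ.L x a × ℝ.U x b × ℝ.L y c × ℝ.U y d) ×
       (∣ a * c - a * c ∣ < η × ∣ a * d - a * c ∣ < η × ∣ b * c - a * c ∣ < η × ∣ b * d - a * c ∣ < η)))
      → Lᵐ x y p ⊎ Uᵐ x y r
    go (a , b , c , d , cuts , h₁ , h₂ , h₃ , h₄) with ≤-total (p + η) (a * c)
    ... | inj₁ h = inj₁ (a , b , c , d , cuts , above h₁ h , above h₂ h , above h₃ h , above h₄ h)
    ... | inj₂ h = inj₂ (a , b , c , d , cuts , below h₁ h′ , below h₂ h′ , below h₃ h′ , below h₄ h′)
      where h′ = ≤-trans h p+η≤r-η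

  min₄ : ∀ {p s t u v} → p < s × p < t × p < u × p < v →
    ∃[ r ] (p < r × (r < s × r < t × r < u × r < v))
  min₄ {p} {s} {t} {u} {v} (ps , pt , pu , pv) with <-dense p<m
    where
    glb : ∀ {a b} → p < a → p < b → p < a ⊓ b
    glb {a} {b} pa pb with ⊓-sel a b
    ... | inj₁ eq = subst (p <_) (sym eq) pa
    ... | inj₂ eq = subst (p <_) (sym eq) pb
    p<m : p < (s ⊓ t) ⊓ (u ⊓ v)
    p<m = glb (glb ps pt) (glb pu pv)
  ... | r , p<r , r<m = r , p<r ,
    <-≤-trans r<m (≤-trans (p⊓q≤p (s ⊓ t) _) (p⊓q≤p s t)) ,
    <-≤-trans r<m (≤-trans (p⊓q≤p (s ⊓ t) _) (p⊓q≤q s t)) ,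
    <-≤-trans r<m (≤-trans (p⊓q≤q (s ⊓ t) _) (p⊓q≤p u v)) ,
    <-≤-trans r<m (≤-trans (p⊓q≤q (s ⊓ t) _) (p⊓q≤q u v))

  max₄ : ∀ {p s t u v} → s < p × t < p × u < p × v < p →
    ∃[ r ] (r < p × (s < r × t < r × u < r × v < r))
  max₄ {p} {s} {t} {u} {v} (sp , tp , up , vp) with <-dense m<p
    where
    lub : ∀ {a b} → a < p → b < p → a ⊔ b < p
    lub {a} {b} ap bp with ⊔-sel a b
    ... | inj₁ eq = subst (_< p) (sym eq) ap
    ... | inj₂ eq = subst (_< p) (sym eq) bp
    m<p : (s ⊔ t) ⊔ (u ⊔ v) < p
    m<p = lub (lub sp tp) (lub up vp)
  ... | r , m<r , r<p = r , r<p ,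
    ≤-<-trans (≤-trans (p≤p⊔q s t) (p≤p⊔q (s ⊔ t) _)) m<r ,
    ≤-<-trans (≤-trans (p≤q⊔p s t) (p≤p⊔q (s ⊔ t) _)) m<r ,
    ≤-<-trans (≤-trans (p≤p⊔q u v) (p≤q⊔p (s ⊔ t) _)) m<r ,
    ≤-<-trans (≤-trans (p≤q⊔p u v) (p≤q⊔p (s ⊔ t) _)) m<r

  disjointᵐ : ∀ x y {p} → Lᵐ x y p → ¬ Uᵐ x y p
  disjointᵐ x y
    (a , b , c , d , (La , Ub , Lc , Ud) , lower)
    (a′ , b′ , c′ , d′ , (La′ , Ub′ , Lc′ , Ud′) , upper) =
    <-asym
      (bilinear-lower (p≤p⊔q a a′) (<⇒≤ (X.L<U L⊔ˣ Ub)) (p≤p⊔q c c′) (<⇒≤ (Y.L<U L⊔ʸ Ud)) lower)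
      (bilinear-upper (p≤q⊔p a a′) (<⇒≤ (X.L<U L⊔ˣ Ub′)) (p≤q⊔p c c′) (<⇒≤ (Y.L<U L⊔ʸ Ud′)) upper)
    where
    module X = ℝ x
    module Y = ℝ y
    L⊔ˣ = L-⊔ x La La′
    L⊔ʸ = L-⊔ y Lc Lc′

infixl 7 _*ʳ_

_*ʳ_ : ℝ → ℝ → ℝ
x *ʳ y = record
  { L         = Lᵐ x y
  ; U         = Uᵐ x y
  ; L-inhab   = let (a , b , c , d , cuts , h₁ , h₂ , h₃ , h₄) = fine x y 0<1
                    low = ≤-reflexive (solve 1 (λ m → (m :- con 1ℚ) :+ con 1ℚ := m) refl (a * c))
                in a * c - 1ℚ , a , b , c , d , cuts ,
                   above h₁ low , above h₂ low , above h₃ low , above h₄ low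
  ; U-inhab   = let (a , b , c , d , cuts , h₁ , h₂ , h₃ , h₄) = fine x y 0<1
                    up = ≤-reflexive (solve 1 (λ m → m := (m :+ con 1ℚ) :- con 1ℚ) refl (a * c))
                in a * c + 1ℚ , a , b , c , d , cuts ,
                   below h₁ up , below h₂ up , below h₃ up , below h₄ up
  ; L-closed  = λ { p<r (a , b , c , d , cuts , h₁ , h₂ , h₃ , h₄) → a , b , c , d , cuts ,
                    <-trans p<r h₁ , <-trans p<r h₂ , <-trans p<r h₃ , <-trans p<r h₄ }
  ; L-rounded = λ { (a , b , c , d , cuts , h) →
                    let r , p<r , h′ = min₄ h in r , p<r , a , b , c , d , cuts , h′ }
  ; U-closed  = λ { r<p (a , b , c , d , cuts , h₁ , h₂ , h₃ , h₄) → a , b , c , d , cuts ,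
                    <-trans h₁ r<p , <-trans h₂ r<p , <-trans h₃ r<p , <-trans h₄ r<p }
  ; U-rounded = λ { (a , b , c , d , cuts , h) →
                    let r , r<p , h′ = max₄ h in r , r<p , a , b , c , d , cuts , h′ }
  ; disjoint  = disjointᵐ x y
  ; located   = locᵐ x y
  }
  where
  0<1 : 0ℚ < 1ℚ
  0<1 = positive⁻¹ 1ℚ

------------------------------------------------------------------------
-- The plane over F_q, for q prime: F_q is Fin q with arithmetic mod q.
-- Subsets E are decidable predicates, so that |E| is a natural number.

F : ℕ → Set
F = Fin

Point : ℕ → Set
Point q = F q × F q

-- A matrix is its pair of rows.
Matrix : ℕ → Set
Matrix q = Point q × Point q

Triple : ℕ → Set
Triple q = Point q × Point q × Point q

module _ {q : ℕ} .{{_ : ℕ.NonZero q}} where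

  infixl 6 _+ᶠ_ _⊕_
  infixl 7 _*ᶠ_ _⊗_ _·_

  0ᶠ 1ᶠ : F q
  0ᶠ = 0 mod q
  1ᶠ = 1 mod q

  _+ᶠ_ _*ᶠ_ : F q → F q → F q
  a +ᶠ b = (toℕ a ℕ.+ toℕ b) mod q
  a *ᶠ b = (toℕ a ℕ.* toℕ b) mod q

  _⊕_ : Point q → Point q → Point q
  (x₁ , x₂) ⊕ (y₁ , y₂) = (x₁ +ᶠ y₁ , x₂ +ᶠ y₂)

  _·_ : Matrix q → Point q → Point q
  ((a , b) , (c , d)) · (x₁ , x₂) = (a *ᶠ x₁ +ᶠ b *ᶠ x₂ , c *ᶠ x₁ +ᶠ d *ᶠ x₂)

  _ᵀ : Matrix q → Matrix q
  ((a , b) , (c , d)) ᵀ = ((a , c) , (b , d))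

  -- The columns of A ⊗ B are A applied to the columns of B.
  _⊗_ : Matrix q → Matrix q → Matrix q
  A ⊗ B = let (u , v) = B ᵀ in (A · u , A · v) ᵀ

  I : Matrix q
  I = ((1ᶠ , 0ᶠ) , (0ᶠ , 1ᶠ))

  Orthogonal : Matrix q → Set
  Orthogonal A = (A ᵀ) ⊗ A ≡ I

  infix 4 _≅_ _≅?_

  _≅_ : Triple q → Triple q → Set
  (x¹ , x² , x³) ≅ (y¹ , y² , y³) = ∃[ θ ] (Orthogonal θ × ∃[ τ ]
    (y¹ ≡ θ · x¹ ⊕ τ × y² ≡ θ · x² ⊕ τ × y³ ≡ θ · x³ ⊕ τ))

  private
    infix 4 _≟ᵖ_ _≟ᵐ_

    _≟ᵖ_ : DecidableEquality (Point q)
    _≟ᵖ_ = ≡-dec Fin._≟_ Fin._≟_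

    _≟ᵐ_ : DecidableEquality (Matrix q)
    _≟ᵐ_ = ≡-dec _≟ᵖ_ _≟ᵖ_

    anyPoint? : ∀ {P : Pred (Point q) 0ℓ} → Decidable P → Dec (∃ P)
    anyPoint? P? = map′ (λ (a , b , p) → (a , b) , p) (λ ((a , b) , p) → a , b , p)
      (Fin.any? λ a → Fin.any? λ b → P? (a , b))

    anyMatrix? : ∀ {P : Pred (Matrix q) 0ℓ} → Decidable P → Dec (∃ P)
    anyMatrix? P? = map′ (λ (a , b , p) → (a , b) , p) (λ ((a , b) , p) → a , b , p)
      (anyPoint? λ a → anyPoint? λ b → P? (a , b))

  _≅?_ : ∀ s t → Dec (s ≅ t)
  (x¹ , x² , x³) ≅? (y¹ , y² , y³) = anyMatrix? λ θ → ((θ ᵀ) ⊗ θ ≟ᵐ I) ×-dec (anyPoint? λ τ →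
    (y¹ ≟ᵖ θ · x¹ ⊕ τ) ×-dec (y² ≟ᵖ θ · x² ⊕ τ) ×-dec (y³ ≟ᵖ θ · x³ ⊕ τ))

  points : List (Point q)
  points = cartesianProduct (allFin q) (allFin q)

  elements : {E : Pred (Point q) 0ℓ} → Decidable E → List (Point q)
  elements E? = filter E? points

  card : {E : Pred (Point q) 0ℓ} → Decidable E → ℕ
  card E? = length (elements E?)

  triangles : {E : Pred (Point q) 0ℓ} → Decidable E → List (Triple q)
  triangles E? = cartesianProduct (elements E?) (cartesianProduct (elements E?) (elements E?))

  -- |T₂(E)|.  A congruence class meeting E³ is represented by its first
  -- member in the list of triangles of E, so classes are counted once each.
  card-T₂ : {E : Pred (Point q) 0ℓ} → Decidable E → ℕ
  card-T₂ E? = length (deduplicate _≅?_ (triangles E?))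

{-# OPTIONS --safe #-}
module Submission where

open import Algebra.Bundles using (CommutativeRing)
open import Algebra.Core using (Op₁; Op₂)
import Algebra.Properties.AbelianGroup as AbelianGroupProperties
import Algebra.Properties.CommutativeMonoid.Sum as CommutativeMonoidSum
import Algebra.Properties.Monoid.Mult as MonoidMult
import Algebra.Properties.Ring as RingProperties
import Algebra.Properties.Semiring.Mult.TCOptimised as SemiringMult
import Algebra.Solver.Ring as RingSolver
open import Algebra.Solver.Ring.AlmostCommutativeRing using (fromCommutativeRing; _-Raw-AlmostCommutative⟶_)
open import Algebra.Structures using (IsCommutativeRing)
open import Data.Bool.Base using (if_then_else_)
open import Data.Fin.Base using (Fin; toℕ) renaming (zero to fzero; suc to fsuc)
open import Data.Fin.Permutation using (Permutation; permutation)
import Data.Fin.Properties as Fin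
open import Data.Integer.Base as ℤ using (ℤ; -[1+_])
import Data.Integer.Properties as ℤ
open import Data.List.Base using (List; []; _∷_; _++_; length; map; filter; deduplicate; allFin; cartesianProduct)
open import Data.List.Membership.Propositional using (_∈_; find)
open import Data.List.Membership.Propositional.Properties using (∈-allFin; ∈-cartesianProduct⁺; ∈-filter⁺)
open import Data.List.Properties using (map-++; map-∘; map-cong; length-tabulate)
open import Data.List.Relation.Unary.All as All using (All; []; _∷_)
open import Data.List.Relation.Unary.AllPairs as AllPairs using (AllPairs; []; _∷_)
open import Data.List.Relation.Unary.Any as Any using (here; there)
import Data.List.Relation.Unary.Any.Properties as Any
open import Data.List.Relation.Unary.Unique.DecSetoid.Properties using (deduplicate-!)
open import Data.List.Relation.Unary.Unique.Propositional using (Unique)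
open import Data.List.Relation.Unary.Unique.Propositional.Properties using (allFin⁺; cartesianProduct⁺; filter⁺)
import Data.Maybe.Base as Maybe
open import Data.Nat.Base as ℕ using (ℕ; zero; suc; NonZero; _^_; _%_; _/_)
open import Data.Nat.Coprimality using (prime⇒coprime; coprime-Bézout)
open import Data.Nat.Divisibility using (_∣_; divides; m%n≡0⇒n∣m; n∣m⇒m%n≡0; ∣⇒≤)
open import Data.Nat.DivMod using (_mod_; m%n<n; m<n⇒m%n≡m; %-distribˡ-+; %-distribˡ-*; n%n≡0; m*n%n≡0; [m+kn]%n≡m%n; m≡m%n+[m/n]*n)
open import Data.Nat.GCD using (module Bézout)
open import Data.Nat.ListAction using (sum)
open import Data.Nat.ListAction.Properties using (sum-++)
open import Data.Nat.Primality using (Prime; euclidsLemma; prime⇒nonTrivial)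
import Data.Nat.Properties as ℕ
open import Data.Nat.Solver using (module +-*-Solver)
open import Data.Nat.Tactic.RingSolver using (solve-∀)
open import Data.Product.Base using (_×_; _,_; proj₁; proj₂; ∃-syntax; Σ-syntax)
open import Data.Product.Properties using (≡-dec)
open import Data.Rational.Base as ℚ using (ℚ; 0ℚ; 1ℚ)
import Data.Rational.Properties as ℚ
import Data.Rational.Unnormalised.Base as ℚᵘ
import Data.Rational.Unnormalised.Properties as ℚᵘ
open import Data.Sum.Base using (_⊎_; inj₁; inj₂; [_,_]′)
open import Function.Base using (_∘_; id)
open import Function.Bundles using (_↔_; Inverse; mk↔ₛ′)
open import Function.Construct.Identity using (↔-id)
open import Level using (0ℓ)
open import Relation.Binary.Bundles using (DecSetoid)
open import Relation.Binary.Core using (Rel)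
open import Relation.Binary.Definitions as Binary using (DecidableEquality)
open import Relation.Binary.PropositionalEquality
  using (_≡_; _≢_; refl; sym; trans; cong; cong₂; subst; subst₂; module ≡-Reasoning)
open import Relation.Binary.PropositionalEquality.Algebra using (isMagma)
open import Relation.Binary.Structures using (IsEquivalence)
open import Relation.Nullary.Decidable using (Dec; yes; no; does; dec⇒maybe)
open import Relation.Nullary.Negation using (¬_; contradiction)
open import Relation.Unary using (Pred; Decidable)
open import Defs

-- The planes y = θ x + τ in F_q⁴, for θ in the circle group a² + b² = 1,
-- form one parallel class for each θ.  Since −1 is not a square, distinct
-- rotations differ by an invertible map, so planes of different classes meet
-- in exactly one point and the functions constant on the classes, with mean
-- zero, are mutually orthogonal.  Bessel's inequality for the indicator of
-- E × E therefore bounds the variance of ν(θ, τ) = #{x ∈ E : θ x + τ ∈ E} by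
-- q² |E|², and with ν ≤ |E| this gives ∑ ν³ ≤ 5 |E|⁶ / q³ as soon as
-- |E|⁴ ≥ q⁷.  Reflections are handled by conjugating one copy of E.
-- Congruent pairs of triangles number at most ∑ ν³ over all isometries, so
-- Cauchy–Schwarz over the congruence classes, |E|⁶ ≤ |T₂(E)| ∑ ν³, yields
-- |T₂(E)| ≥ q³ / 10.

-- Finite sums and indicators

-- Write `s` for |E| and `t` for the number of congruence classes met by the `s ^ 3` triangles.
-- Cauchy-Schwarz over the classes gives s⁶ ≤ t · N, where N is the number of ordered pairs of
-- congruent triangles (`length²≤classes*pairs`), so N has to be bounded by a multiple of s⁶ / q³.
--
-- An orthogonal matrix has determinant 1 or -1 and acts as multiplication by some z = a + bi of
-- norm one, preceded by conjugation when the determinant is -1 (`≅⇒rigid`). For fixed z and τ the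
-- three vertices can be matched independently, so exactly ν(z, τ)³ pairs of triangles are related
-- by x ↦ zx + τ. Hence N is at most the sum of ν³ over rotations plus the same sum with one copy of
-- E conjugated (`congruent-pairs`).
--
-- For each z the values ν(z, τ) sum to s² over the q² translations. If all were equal to the mean
-- s² / q², then, there being at most 2q points on the circle, the cubes would sum to at most 2 s⁶ /
-- q³, which is the desired order. The deviation from the mean is controlled in L² by
-- `energy-bound`, ∑ (ν - s²/q²)² ≤ q² s², and `cubes-bound` passes to third moments using ν ≤ s: q⁴
-- ∑ ν³ ≤ q⁶ s³ + 2 q⁴ s⁴ + |circle| s⁶. From q⁷ ≤ s⁴ follow q⁵ ≤ s³ and q³ ≤ s², which make the
-- right side at most 5 q s⁶.
--
-- The congruence q ≡ 3 mod 4 enters through `-1-nonsquare`: the form a² + b² is then anisotropic,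
-- so z - z′ is invertible for z ≠ z′, and the planes y = zx + τ and y = z′x + τ′ meet in exactly
-- one point. This is the orthogonality on which `energy-bound` rests.

module FiniteSums where

  open import Data.Nat.Base using (_+_; _*_; _∸_; _≤_; z≤n; s≤s)
  open import Data.Nat.Properties hiding (_≟_)

  private variable
    A B : Set

  ∑ : List A → (A → ℕ) → ℕ
  ∑ xs f = sum (map f xs)

  infix 5 ∑
  syntax ∑ xs (λ x → e) = ∑[ x ∈ xs ] e

  ∑-cong : {f g : A → ℕ} → (∀ x → f x ≡ g x) → ∀ xs → ∑ xs f ≡ ∑ xs g
  ∑-cong f≗g xs = cong sum (map-cong f≗g xs)

  ∑-mono : {f g : A → ℕ} → (∀ x → f x ≤ g x) → ∀ xs → ∑ xs f ≤ ∑ xs g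
  ∑-mono f≤g []       = z≤n
  ∑-mono f≤g (x ∷ xs) = +-mono-≤ (f≤g x) (∑-mono f≤g xs)

  ∑-mono-∈ : ∀ xs {f g : A → ℕ} → (∀ {x} → x ∈ xs → f x ≤ g x) → ∑ xs f ≤ ∑ xs g
  ∑-mono-∈ []       f≤g = z≤n
  ∑-mono-∈ (x ∷ xs) f≤g = +-mono-≤ (f≤g (here refl)) (∑-mono-∈ xs (f≤g ∘ there))

  ∑-++ : ∀ xs ys (f : A → ℕ) → ∑ (xs ++ ys) f ≡ ∑ xs f + ∑ ys f
  ∑-++ xs ys f = trans (cong sum (map-++ f xs ys)) (sum-++ (map f xs) (map f ys))

  ∑-+ : ∀ xs (f g : A → ℕ) → (∑[ x ∈ xs ] f x + g x) ≡ ∑ xs f + ∑ xs g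
  ∑-+ []       f g = refl
  ∑-+ (x ∷ xs) f g rewrite ∑-+ xs f g = interchange (f x) (g x) (∑ xs f) (∑ xs g)
    where
    interchange : ∀ a b c d → a + b + (c + d) ≡ a + c + (b + d)
    interchange = solve-∀

  ∑-*ˡ : ∀ k xs (f : A → ℕ) → (∑[ x ∈ xs ] k * f x) ≡ k * ∑ xs f
  ∑-*ˡ k []       f = sym (*-zeroʳ k)
  ∑-*ˡ k (x ∷ xs) f rewrite ∑-*ˡ k xs f = sym (*-distribˡ-+ k (f x) (∑ xs f))

  ∑-*ʳ : ∀ xs (f : A → ℕ) k → (∑[ x ∈ xs ] f x * k) ≡ ∑ xs f * k
  ∑-*ʳ xs f k = trans (∑-cong (λ x → *-comm (f x) k) xs) (trans (∑-*ˡ k xs f) (*-comm k (∑ xs f)))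

  ∑-const : ∀ (xs : List A) k → (∑[ _ ∈ xs ] k) ≡ length xs * k
  ∑-const []       k = refl
  ∑-const (x ∷ xs) k = cong (k +_) (∑-const xs k)

  ∑-linear : ∀ xs a b (f g : A → ℕ) → (∑[ x ∈ xs ] a * f x + b * g x) ≡ a * ∑ xs f + b * ∑ xs g
  ∑-linear xs a b f g = trans (∑-+ xs (λ x → a * f x) (λ x → b * g x))
    (cong₂ _+_ (∑-*ˡ a xs f) (∑-*ˡ b xs g))

  ∑-swap : ∀ xs ys (f : A → B → ℕ) → (∑[ x ∈ xs ] ∑[ y ∈ ys ] f x y) ≡ (∑[ y ∈ ys ] ∑[ x ∈ xs ] f x y)
  ∑-swap []       ys f = sym (trans (∑-const ys 0) (*-zeroʳ (length ys)))
  ∑-swap (x ∷ xs) ys f = trans (cong (∑ ys (f x) +_) (∑-swap xs ys f))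
    (sym (∑-+ ys (f x) (λ y → ∑[ z ∈ xs ] f z y)))

  ∑-map : ∀ (h : A → B) xs (f : B → ℕ) → ∑ (map h xs) f ≡ ∑ xs (f ∘ h)
  ∑-map h xs f = cong sum (sym (map-∘ xs))

  ∑-cartesianProduct : ∀ xs ys (f : A × B → ℕ) →
    ∑ (cartesianProduct xs ys) f ≡ (∑[ x ∈ xs ] ∑[ y ∈ ys ] f (x , y))
  ∑-cartesianProduct []       ys f = refl
  ∑-cartesianProduct (x ∷ xs) ys f = trans (∑-++ (map (x ,_) ys) (cartesianProduct xs ys) f)
    (cong₂ _+_ (∑-map (x ,_) ys f) (∑-cartesianProduct xs ys f))

  ∑-product : ∀ xs ys (f : A → ℕ) (g : B → ℕ) →
    (∑[ x ∈ xs ] ∑[ y ∈ ys ] f x * g y) ≡ ∑ xs f * ∑ ys g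
  ∑-product xs ys f g = trans (∑-cong (λ x → ∑-*ˡ (f x) ys g) xs) (∑-*ʳ xs f (∑ ys g))

  ∈⇒≤∑ : ∀ {xs} {x : A} (f : A → ℕ) → x ∈ xs → f x ≤ ∑ xs f
  ∈⇒≤∑ f (here refl) = m≤m+n (f _) _
  ∈⇒≤∑ {xs = y ∷ ys} f (there x∈xs) = ≤-trans (∈⇒≤∑ f x∈xs) (m≤n+m (∑ ys f) (f y))

  length≡∑1 : ∀ (xs : List A) → length xs ≡ (∑[ _ ∈ xs ] 1)
  length≡∑1 xs = sym (trans (∑-const xs 1) (*-identityʳ (length xs)))

  length-cartesianProduct : ∀ (xs : List A) (ys : List B) → length (cartesianProduct xs ys) ≡ length xs * length ys
  length-cartesianProduct xs ys = trans (length≡∑1 (cartesianProduct xs ys))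
    (trans (∑-cartesianProduct xs ys (λ _ → 1))
      (trans (∑-cong (λ _ → sym (length≡∑1 ys)) xs) (∑-const xs (length ys))))

  -- If the larger number is the smaller one plus d, the two sides differ by d²; splitting by order
  -- keeps the square (a - b)² within ℕ.
  2ab≤a²+b² : ∀ a b → 2 * (a * b) ≤ a * a + b * b
  2ab≤a²+b² a b with ≤-total a b
  ... | inj₁ a≤b = subst (λ b → 2 * (a * b) ≤ a * a + b * b) (m+[n∸m]≡n a≤b) (ordered a (b ∸ a))
    where
    expand : ∀ a d → a * a + (a + d) * (a + d) ≡ 2 * (a * (a + d)) + d * d
    expand = solve-∀
    ordered : ∀ a d → 2 * (a * (a + d)) ≤ a * a + (a + d) * (a + d)
    ordered a d = subst (2 * (a * (a + d)) ≤_) (sym (expand a d)) (m≤m+n _ _)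
  ... | inj₂ b≤a = subst (λ a → 2 * (a * b) ≤ a * a + b * b) (m+[n∸m]≡n b≤a) (ordered b (a ∸ b))
    where
    expand : ∀ b d → (b + d) * (b + d) + b * b ≡ 2 * ((b + d) * b) + d * d
    expand = solve-∀
    ordered : ∀ b d → 2 * ((b + d) * b) ≤ (b + d) * (b + d) + b * b
    ordered b d = subst (2 * ((b + d) * b) ≤_) (sym (expand b d)) (m≤m+n _ _)

  -- Induction on the list: each new cross term 2 f(x) f(y) is at most f(x)² + f(y)².
  ∑-cauchy : ∀ xs (f : A → ℕ) → ∑ xs f * ∑ xs f ≤ length xs * (∑[ x ∈ xs ] f x * f x)
  ∑-cauchy []       f = z≤n
  ∑-cauchy (x ∷ xs) f = begin
    (a + s) * (a + s)                        ≡⟨ expand a s ⟩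
    a * a + (2 * (a * s) + s * s)            ≤⟨ +-monoʳ-≤ (a * a) (+-mono-≤ cross (∑-cauchy xs f)) ⟩
    a * a + (l * (a * a) + t + l * t)        ≡⟨ collect a l t ⟩
    suc l * (a * a + t)                      ∎
    where
    open ≤-Reasoning
    a = f x
    s = ∑ xs f
    t = ∑[ y ∈ xs ] f y * f y
    l = length xs
    expand : ∀ a s → (a + s) * (a + s) ≡ a * a + (2 * (a * s) + s * s)
    expand = solve-∀
    collect : ∀ a l t → a * a + (l * (a * a) + t + l * t) ≡ suc l * (a * a + t)
    collect = solve-∀
    cross : 2 * (a * s) ≤ l * (a * a) + t
    cross = begin
      2 * (a * s)                              ≡⟨ *-assoc 2 a s ⟨
      2 * a * s                                ≡⟨ ∑-*ˡ (2 * a) xs f ⟨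
      (∑[ y ∈ xs ] 2 * a * f y)                ≤⟨ ∑-mono (λ y → subst (_≤ a * a + f y * f y) (sym (*-assoc 2 a (f y))) (2ab≤a²+b² a (f y))) xs ⟩
      (∑[ y ∈ xs ] a * a + f y * f y)          ≡⟨ ∑-+ xs (λ _ → a * a) (λ y → f y * f y) ⟩
      (∑[ _ ∈ xs ] a * a) + t                  ≡⟨ cong (_+ t) (∑-const xs (a * a)) ⟩
      l * (a * a) + t                          ∎

  ⟦_⟧ : ∀ {p} {P : Set p} → Dec P → ℕ
  ⟦ P? ⟧ = if does P? then 1 else 0

  module _ {p} {P : Set p} where

    ⟦⟧-true : (P? : Dec P) → P → ⟦ P? ⟧ ≡ 1
    ⟦⟧-true (yes _) _ = refl
    ⟦⟧-true (no ¬p) p = contradiction p ¬p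

    ⟦⟧-false : (P? : Dec P) → ¬ P → ⟦ P? ⟧ ≡ 0
    ⟦⟧-false (yes p) ¬p = contradiction p ¬p
    ⟦⟧-false (no _)  _  = refl

    ⟦⟧-idem : (P? : Dec P) → ⟦ P? ⟧ * ⟦ P? ⟧ ≡ ⟦ P? ⟧
    ⟦⟧-idem (yes _) = refl
    ⟦⟧-idem (no _)  = refl

    ⟦⟧≤1 : (P? : Dec P) → ⟦ P? ⟧ ≤ 1
    ⟦⟧≤1 (yes _) = s≤s z≤n
    ⟦⟧≤1 (no _)  = z≤n

    ⟦⟧-bound : ∀ {k} (P? : Dec P) → (P → 1 ≤ k) → ⟦ P? ⟧ ≤ k
    ⟦⟧-bound (yes p) h = h p
    ⟦⟧-bound (no _)  h = z≤n

  ⟦⟧-mono : ∀ {p r} {P : Set p} {R : Set r} (P? : Dec P) (R? : Dec R) → (P → R) → ⟦ P? ⟧ ≤ ⟦ R? ⟧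
  ⟦⟧-mono P? R? f = ⟦⟧-bound P? (λ p → ≤-reflexive (sym (⟦⟧-true R? (f p))))

  ⟦⟧-⇔ : ∀ {p r} {P : Set p} {R : Set r} (P? : Dec P) (R? : Dec R) → (P → R) → (R → P) → ⟦ P? ⟧ ≡ ⟦ R? ⟧
  ⟦⟧-⇔ P? R? f g = ≤-antisym (⟦⟧-mono P? R? f) (⟦⟧-mono R? P? g)

  ∑-filter : ∀ {P : Pred A 0ℓ} (P? : Decidable P) xs (f : A → ℕ) →
    ∑ (filter P? xs) f ≡ (∑[ x ∈ xs ] ⟦ P? x ⟧ * f x)
  ∑-filter P? []       f = refl
  ∑-filter P? (x ∷ xs) f with P? x
  ... | yes _ = cong₂ _+_ (sym (*-identityˡ (f x))) (∑-filter P? xs f)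
  ... | no  _ = ∑-filter P? xs f

  module Listing {P : Set} (_≟_ : DecidableEquality P)
    (pts : List P) (unique : Unique pts) (complete : ∀ a → a ∈ pts) where

    private
      ∑-δ-absent : ∀ {a xs} (h : P → ℕ) → All (a ≢_) xs → (∑[ x ∈ xs ] ⟦ x ≟ a ⟧ * h x) ≡ 0
      ∑-δ-absent h []           = refl
      ∑-δ-absent {a} {x ∷ _} h (a≢x ∷ rest)
        rewrite ⟦⟧-false (x ≟ a) (a≢x ∘ sym) = ∑-δ-absent h rest

      ∑-δ′ : ∀ {a xs} (h : P → ℕ) → Unique xs → a ∈ xs → (∑[ x ∈ xs ] ⟦ x ≟ a ⟧ * h x) ≡ h a
      ∑-δ′ {a} h (a∉ ∷ _) (here refl) rewrite ⟦⟧-true (a ≟ a) refl | ∑-δ-absent h a∉ =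
        trans (+-identityʳ _) (+-identityʳ _)
      ∑-δ′ {a} h (x∉ ∷ u) (there a∈xs) rewrite ⟦⟧-false (_ ≟ a) (All.lookup x∉ a∈xs) = ∑-δ′ h u a∈xs

    ∑-δ : ∀ a (h : P → ℕ) → (∑[ x ∈ pts ] ⟦ x ≟ a ⟧ * h x) ≡ h a
    ∑-δ a h = ∑-δ′ h unique (complete a)

    -- Expanding h(φ x) over point masses and exchanging the sums reduces a change of variables to
    -- `∑-δ`, so no permutation of the list has to be exhibited.
    ∑-reindex : ∀ (φ : P ↔ P) (h : P → ℕ) → (∑[ x ∈ pts ] h (Inverse.to φ x)) ≡ ∑ pts h
    ∑-reindex φ h = begin
      (∑[ x ∈ pts ] h (to x))                               ≡⟨ ∑-cong (λ x → sym (∑-δ (to x) h)) pts ⟩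
      (∑[ x ∈ pts ] ∑[ y ∈ pts ] ⟦ y ≟ to x ⟧ * h y)        ≡⟨ ∑-swap pts pts _ ⟩
      (∑[ y ∈ pts ] ∑[ x ∈ pts ] ⟦ y ≟ to x ⟧ * h y)        ≡⟨ ∑-cong (λ y → ∑-cong (λ x → cong (_* h y) (adjoint x y)) pts) pts ⟩
      (∑[ y ∈ pts ] ∑[ x ∈ pts ] ⟦ x ≟ from y ⟧ * h y)      ≡⟨ ∑-cong (λ y → ∑-δ (from y) (λ _ → h y)) pts ⟩
      ∑ pts h                                               ∎
      where
      open ≡-Reasoning
      open Inverse φ using (to; from; strictlyInverseˡ; strictlyInverseʳ)
      adjoint : ∀ x y → ⟦ y ≟ to x ⟧ ≡ ⟦ x ≟ from y ⟧
      adjoint x y = ⟦⟧-⇔ (y ≟ to x) (x ≟ from y)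
        (λ { refl → sym (strictlyInverseʳ x) }) (λ { refl → sym (strictlyInverseˡ y) })

    ∑-reindex⁻¹ : ∀ (φ : P ↔ P) (h : P → ℕ) → (∑[ x ∈ pts ] h (Inverse.from φ x)) ≡ ∑ pts h
    ∑-reindex⁻¹ φ h = trans (sym (∑-reindex φ (h ∘ Inverse.from φ)))
      (∑-cong (λ x → cong h (Inverse.strictlyInverseʳ φ x)) pts)

open FiniteSums

-- Nets of transversal classes

module Net {P : Set} (_≟_ : DecidableEquality P)
  (pts : List P) (unique : Unique pts) (complete : ∀ a → a ∈ pts)
  {Θ : Set} (label : Θ → P → P ↔ P) (f : P → P → ℕ) where

  open import Data.Nat.Base using (_+_; _*_; _∸_; _≤_)
  open import Data.Nat.Properties hiding (_≟_)
  open Listing _≟_ pts unique complete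

  -- A class θ partitions P × P into blocks, one for each τ: `lab θ x y` names the block through (x,
  -- y), and `at θ x τ` is the point of block τ above x.
  lab at : Θ → P → P → P
  lab θ x = Inverse.to (label θ x)
  at  θ x = Inverse.from (label θ x)

  -- Along block τ of θ, parametrised by x, the label in θ′ takes every value exactly once: the
  -- block meets each block of θ′ in one point.
  Transversal : Θ → Θ → Set
  Transversal θ θ′ = ∀ τ → Σ[ φ ∈ (P ↔ P) ] (∀ x → Inverse.to φ x ≡ lab θ′ x (at θ x τ))

  n m : ℕ
  n = length pts
  m = ∑[ x ∈ pts ] ∑[ y ∈ pts ] f x y

  -- The mass that `f` puts on block τ. Since a block has `n` points, ν / n is the projection of `f`
  -- to the functions constant on the blocks of θ.
  ν : Θ → P → ℕ
  ν θ τ = ∑[ x ∈ pts ] f x (at θ x τ)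

  -- Up to the factor `n`, the sum of the projections of `f` to all the classes.
  richness : List Θ → P → P → ℕ
  richness Θs x y = ∑[ θ ∈ Θs ] ν θ (lab θ x y)

  energy cubes : List Θ → ℕ
  energy Θs = ∑[ θ ∈ Θs ] ∑[ τ ∈ pts ] ν θ τ * ν θ τ
  cubes  Θs = ∑[ θ ∈ Θs ] ∑[ τ ∈ pts ] ν θ τ * ν θ τ * ν θ τ

  private
    ∑∑ : (P → P → ℕ) → ℕ
    ∑∑ g = ∑[ x ∈ pts ] ∑[ y ∈ pts ] g x y

    ∑∑-cong : ∀ {g h} → (∀ x y → g x y ≡ h x y) → ∑∑ g ≡ ∑∑ h
    ∑∑-cong eq = ∑-cong (λ x → ∑-cong (eq x) pts) pts

    ∑∑-linear : ∀ a b g h → ∑∑ (λ x y → a * g x y + b * h x y) ≡ a * ∑∑ g + b * ∑∑ h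
    ∑∑-linear a b g h = trans (∑-cong (λ x → ∑-linear pts a b (g x) (h x)) pts)
      (∑-linear pts a b (λ x → ∑ pts (g x)) (λ x → ∑ pts (h x)))

    ∑∑-mono : ∀ {g h} → (∀ x y → g x y ≤ h x y) → ∑∑ g ≤ ∑∑ h
    ∑∑-mono le = ∑-mono (λ x → ∑-mono (le x) pts) pts

    ∑∑-const : ∀ k → ∑∑ (λ _ _ → k) ≡ n * (n * k)
    ∑∑-const k = trans (∑-cong (λ _ → ∑-const pts k) pts) (∑-const pts (n * k))

    ∑∑-∑ : ∀ (Θs : List Θ) (g : Θ → P → P → ℕ) →
      ∑∑ (λ x y → ∑[ θ ∈ Θs ] g θ x y) ≡ (∑[ θ ∈ Θs ] ∑∑ (g θ))
    ∑∑-∑ Θs g = trans (∑-cong (λ x → ∑-swap pts Θs (λ y θ → g θ x y)) pts)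
      (∑-swap pts Θs (λ x θ → ∑ pts (g θ x)))

  ∑-ν : ∀ θ → ∑ pts (ν θ) ≡ m
  ∑-ν θ = trans (∑-swap pts pts (λ τ x → f x (at θ x τ)))
    (∑-cong (λ x → ∑-reindex⁻¹ (label θ x) (f x)) pts)

  ∑∑-lab : ∀ θ h → ∑∑ (λ x y → h (lab θ x y)) ≡ n * ∑ pts h
  ∑∑-lab θ h = trans (∑-cong (λ x → ∑-reindex (label θ x) h) pts) (∑-const pts (∑ pts h))

  ∑∑-f*ν : ∀ θ → ∑∑ (λ x y → f x y * ν θ (lab θ x y)) ≡ (∑[ τ ∈ pts ] ν θ τ * ν θ τ)
  ∑∑-f*ν θ = begin
    ∑∑ (λ x y → f x y * ν θ (lab θ x y))
      ≡⟨ ∑-cong (λ x → sym (∑-reindex⁻¹ (label θ x) (λ y → f x y * ν θ (lab θ x y)))) pts ⟩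
    ∑∑ (λ x τ → f x (at θ x τ) * ν θ (lab θ x (at θ x τ)))
      ≡⟨ ∑∑-cong (λ x τ → cong (λ σ → f x (at θ x τ) * ν θ σ) (Inverse.strictlyInverseˡ (label θ x) τ)) ⟩
    ∑∑ (λ x τ → f x (at θ x τ) * ν θ τ)
      ≡⟨ ∑-swap pts pts _ ⟩
    ∑∑ (λ τ x → f x (at θ x τ) * ν θ τ)
      ≡⟨ ∑-cong (λ τ → ∑-*ʳ pts (λ x → f x (at θ x τ)) (ν θ τ)) pts ⟩
    (∑[ τ ∈ pts ] ν θ τ * ν θ τ) ∎
    where open ≡-Reasoning

  -- Each pair of blocks (τ, τ′) shares exactly one point, so the sum is that of ν θ τ · ν θ′ τ′
  -- over all pairs, which factors. In other words, the projections to the two classes are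
  -- orthogonal apart from their means.
  ∑∑-cross : ∀ {θ θ′} → Transversal θ θ′ →
    ∑∑ (λ x y → ν θ (lab θ x y) * ν θ′ (lab θ′ x y)) ≡ m * m
  ∑∑-cross {θ} {θ′} transversal = begin
    ∑∑ (λ x y → ν θ (lab θ x y) * ν θ′ (lab θ′ x y))
      ≡⟨ ∑-cong (λ x → sym (∑-reindex⁻¹ (label θ x) (λ y → ν θ (lab θ x y) * ν θ′ (lab θ′ x y)))) pts ⟩
    ∑∑ (λ x τ → ν θ (lab θ x (at θ x τ)) * ν θ′ (lab θ′ x (at θ x τ)))
      ≡⟨ ∑∑-cong (λ x τ → cong₂ (λ σ σ′ → ν θ σ * ν θ′ σ′)
           (Inverse.strictlyInverseˡ (label θ x) τ) (sym (proj₂ (transversal τ) x))) ⟩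
    ∑∑ (λ x τ → ν θ τ * ν θ′ (Inverse.to (proj₁ (transversal τ)) x))
      ≡⟨ ∑-swap pts pts _ ⟩
    ∑∑ (λ τ x → ν θ τ * ν θ′ (Inverse.to (proj₁ (transversal τ)) x))
      ≡⟨ ∑-cong (λ τ → trans (∑-*ˡ (ν θ τ) pts _) (cong (ν θ τ *_)
           (trans (∑-reindex (proj₁ (transversal τ)) (ν θ′)) (∑-ν θ′)))) pts ⟩
    (∑[ τ ∈ pts ] ν θ τ * m)
      ≡⟨ trans (∑-*ʳ pts (ν θ) m) (cong (_* m) (∑-ν θ)) ⟩
    m * m ∎
    where open ≡-Reasoning

  ∑∑-richness : ∀ Θs → ∑∑ (richness Θs) ≡ length Θs * (n * m)
  ∑∑-richness Θs = trans (∑∑-∑ Θs (λ θ x y → ν θ (lab θ x y)))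
    (trans (∑-cong (λ θ → trans (∑∑-lab θ (ν θ)) (cong (n *_) (∑-ν θ))) Θs) (∑-const Θs (n * m)))

  ∑∑-f*richness : ∀ Θs → ∑∑ (λ x y → f x y * richness Θs x y) ≡ energy Θs
  ∑∑-f*richness Θs = trans
    (∑∑-cong (λ x y → sym (∑-*ˡ (f x y) Θs (λ θ → ν θ (lab θ x y)))))
    (trans (∑∑-∑ Θs (λ θ x y → f x y * ν θ (lab θ x y))) (∑-cong ∑∑-f*ν Θs))

  ∑∑-ν*richness : ∀ {θ Θs} → All (Transversal θ) Θs →
    ∑∑ (λ x y → ν θ (lab θ x y) * richness Θs x y) ≡ length Θs * (m * m)
  ∑∑-ν*richness {θ} {Θs} ts = trans
    (∑∑-cong (λ x y → sym (∑-*ˡ (ν θ (lab θ x y)) Θs (λ θ′ → ν θ′ (lab θ′ x y)))))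
    (trans (∑∑-∑ Θs (λ θ′ x y → ν θ (lab θ x y) * ν θ′ (lab θ′ x y))) (sum-cross ts))
    where
    sum-cross : ∀ {Θs} → All (Transversal θ) Θs →
      (∑[ θ′ ∈ Θs ] ∑∑ (λ x y → ν θ (lab θ x y) * ν θ′ (lab θ′ x y))) ≡ length Θs * (m * m)
    sum-cross []       = refl
    sum-cross (t ∷ ts) = cong₂ _+_ (∑∑-cross t) (sum-cross ts)

  -- With k classes, the k diagonal terms of the square give `n` times the energy and the k(k - 1)
  -- others give m² each; the term k m² stands on the left to avoid a subtraction.
  ∑∑-richness² : ∀ {Θs} → AllPairs Transversal Θs →
    ∑∑ (λ x y → richness Θs x y * richness Θs x y) + length Θs * (m * m)
      ≡ n * energy Θs + length Θs * length Θs * (m * m)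
  ∑∑-richness² [] = begin
    ∑∑ (λ _ _ → 0) + 0   ≡⟨ cong (_+ 0) (∑∑-const 0) ⟩
    n * (n * 0) + 0      ≡⟨ vanish n ⟩
    n * 0 + 0            ∎
    where
    open ≡-Reasoning
    vanish : ∀ n → n * (n * 0) + 0 ≡ n * 0 + 0
    vanish = solve-∀
  ∑∑-richness² {θ ∷ Θs} (t ∷ ts) = begin
    ∑∑ (λ x y → richness (θ ∷ Θs) x y * richness (θ ∷ Θs) x y) + suc k * M
      ≡⟨ cong (_+ suc k * M) (trans
           (∑∑-cong (λ x y → expand (ν θ (lab θ x y)) (richness Θs x y)))
           (trans (∑∑-linear 1 1 _ _) (cong (1 * ∑∑ (λ x y → ν θ (lab θ x y) * ν θ (lab θ x y)) +_)
             (cong (1 *_) (∑∑-linear 2 1 _ _))))) ⟩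
    1 * ∑∑ (λ x y → ν θ (lab θ x y) * ν θ (lab θ x y))
      + 1 * (2 * ∑∑ (λ x y → ν θ (lab θ x y) * richness Θs x y) + 1 * R) + suc k * M
      ≡⟨ cong₂ (λ u v → 1 * u + 1 * (2 * v + 1 * R) + suc k * M)
           (∑∑-lab θ (λ τ → ν θ τ * ν θ τ)) (∑∑-ν*richness t) ⟩
    1 * (n * q) + 1 * (2 * (k * M) + 1 * R) + suc k * M
      ≡⟨ regroup n q k M R ⟩
    n * q + 2 * (k * M) + M + (R + k * M)
      ≡⟨ cong (n * q + 2 * (k * M) + M +_) (∑∑-richness² ts) ⟩
    n * q + 2 * (k * M) + M + (n * energy Θs + k * k * M)
      ≡⟨ collect n q k M (energy Θs) ⟩
    n * (q + energy Θs) + suc k * suc k * M ∎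
    where
    open ≡-Reasoning
    k = length Θs
    M = m * m
    R = ∑∑ (λ x y → richness Θs x y * richness Θs x y)
    q = ∑[ τ ∈ pts ] ν θ τ * ν θ τ
    expand : ∀ a b → (a + b) * (a + b) ≡ 1 * (a * a) + 1 * (2 * (a * b) + 1 * (b * b))
    expand = solve-∀
    regroup : ∀ n q k M R → 1 * (n * q) + 1 * (2 * (k * M) + 1 * R) + (1 + k) * M ≡ n * q + 2 * (k * M) + M + (R + k * M)
    regroup = solve-∀
    collect : ∀ n q k M e → n * q + 2 * (k * M) + M + (n * e + k * k * M) ≡ n * (q + e) + (1 + k) * (1 + k) * M
    collect = solve-∀

  module _ (f-idem : ∀ x y → f x y * f x y ≡ f x y) .{{_ : NonZero n}} where

    -- Expanding ∑ (n² f + k m − n G)² ≥ 0, where G is the richness: since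
    -- the classes are pairwise transversal, this is Bessel's inequality for
    -- the projections of f to the functions constant on each class.
    energy-bound : ∀ {Θs} → AllPairs Transversal Θs →
      n * energy Θs ≤ n * n * m + length Θs * (m * m)
    energy-bound {Θs} ts = *-cancelˡ-≤ n (*-cancelˡ-≤ n (+-cancelʳ-≤ c _ _ (begin
      n * (n * (n * e)) + c
        ≡⟨ left n m k e ⟩
      2 * n * n * n * e + 2 * n * k * m * (k * (n * m)) + n * n * (k * (m * m))
        ≤⟨ +-monoˡ-≤ (n * n * (k * (m * m))) square ⟩
      n * n * n * n * m + (2 * n * n * k * m * m + (n * n * G² + 1 * (n * (n * (k * m * (k * m)))))) + n * n * (k * (m * m))
        ≡⟨ middle n m k G² ⟩
      n * n * (G² + k * (m * m)) + (n * n * n * n * m + 2 * n * n * k * m * m + n * n * k * k * m * m)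
        ≡⟨ cong (λ z → n * n * z + (n * n * n * n * m + 2 * n * n * k * m * m + n * n * k * k * m * m)) (∑∑-richness² ts) ⟩
      n * n * (n * e + k * k * (m * m)) + (n * n * n * n * m + 2 * n * n * k * m * m + n * n * k * k * m * m)
        ≡⟨ right n m k e ⟩
      n * (n * (n * n * m + k * (m * m))) + c ∎)))
      where
      open ≤-Reasoning
      k = length Θs
      e = energy Θs
      G = richness Θs
      G² = ∑∑ (λ x y → G x y * G x y)
      -- Carries, on both sides, the terms that would have to be subtracted when the square is
      -- expanded.
      c = n * n * n * e + 2 * n * n * k * k * m * m + n * n * k * m * m

      left : ∀ n m k e →
        n * (n * (n * e)) + (n * n * n * e + 2 * n * n * k * k * m * m + n * n * k * m * m)
          ≡ 2 * n * n * n * e + 2 * n * k * m * (k * (n * m)) + n * n * (k * (m * m))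
      left = solve-∀

      middle : ∀ n m k s →
        n * n * n * n * m + (2 * n * n * k * m * m + (n * n * s + 1 * (n * (n * (k * m * (k * m)))))) + n * n * (k * (m * m))
          ≡ n * n * (s + k * (m * m)) + (n * n * n * n * m + 2 * n * n * k * m * m + n * n * k * k * m * m)
      middle = solve-∀

      right : ∀ n m k e →
        n * n * (n * e + k * k * (m * m)) + (n * n * n * n * m + 2 * n * n * k * m * m + n * n * k * k * m * m)
          ≡ n * (n * (n * n * m + k * (m * m))) + (n * n * n * e + 2 * n * n * k * k * m * m + n * n * k * m * m)
      right = solve-∀

      product : ∀ n K a g → 2 * ((n * n * a + K) * (n * g)) ≡ 2 * n * n * n * (a * g) + 2 * n * K * g
      product = solve-∀

      squares : ∀ n K a g → (n * n * a + K) * (n * n * a + K) + n * g * (n * g)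
        ≡ n * n * n * n * (a * a) + 1 * (2 * n * n * K * a + 1 * (n * n * (g * g) + 1 * (K * K)))
      squares = solve-∀

      square : 2 * n * n * n * e + 2 * n * k * m * (k * (n * m))
        ≤ n * n * n * n * m + (2 * n * n * k * m * m + (n * n * G² + 1 * (n * (n * (k * m * (k * m))))))
      square = begin
        2 * n * n * n * e + 2 * n * k * m * (k * (n * m))
          ≡⟨ cong₂ (λ a b → 2 * n * n * n * a + b) (sym (∑∑-f*richness Θs))
               (cong₂ _*_ (*-assoc (2 * n) k m) (sym (∑∑-richness Θs))) ⟩
        2 * n * n * n * ∑∑ (λ x y → f x y * G x y) + 2 * n * (k * m) * ∑∑ G
          ≡⟨ ∑∑-linear (2 * n * n * n) (2 * n * (k * m)) (λ x y → f x y * G x y) G ⟨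
        ∑∑ (λ x y → 2 * n * n * n * (f x y * G x y) + 2 * n * (k * m) * G x y)
          ≡⟨ ∑∑-cong (λ x y → product n (k * m) (f x y) (G x y)) ⟨
        ∑∑ (λ x y → 2 * ((n * n * f x y + k * m) * (n * G x y)))
          ≤⟨ ∑∑-mono (λ x y → 2ab≤a²+b² (n * n * f x y + k * m) (n * G x y)) ⟩
        ∑∑ (λ x y → (n * n * f x y + k * m) * (n * n * f x y + k * m) + n * G x y * (n * G x y))
          ≡⟨ ∑∑-cong (λ x y → squares n (k * m) (f x y) (G x y)) ⟩
        ∑∑ (λ x y → n * n * n * n * (f x y * f x y)
          + 1 * (2 * n * n * (k * m) * f x y + 1 * (n * n * (G x y * G x y) + 1 * (k * m * (k * m)))))
          ≡⟨ trans (∑∑-linear (n * n * n * n) 1 _ _)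
               (cong₂ (λ u v → n * n * n * n * u + 1 * v) (∑∑-cong f-idem)
                 (trans (∑∑-linear (2 * n * n * (k * m)) 1 f _)
                   (cong (λ v → 2 * n * n * (k * m) * m + 1 * v)
                     (trans (∑∑-linear (n * n) 1 _ _)
                       (cong (λ v → n * n * G² + 1 * v) (∑∑-const (k * m * (k * m)))))))) ⟩
        n * n * n * n * m + 1 * (2 * n * n * (k * m) * m + 1 * (n * n * G² + 1 * (n * (n * (k * m * (k * m))))))
          ≡⟨ final n m k G² ⟩
        n * n * n * n * m + (2 * n * n * k * m * m + (n * n * G² + 1 * (n * (n * (k * m * (k * m)))))) ∎
        where
        final : ∀ n m k s →
          n * n * n * n * m + 1 * (2 * n * n * (k * m) * m + 1 * (n * n * s + 1 * (n * (n * (k * m * (k * m))))))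
            ≡ n * n * n * n * m + (2 * n * n * k * m * m + (n * n * s + 1 * (n * (n * (k * m * (k * m))))))
        final = solve-∀

    -- Summing (s − ν) (n ν − m)² ≥ 0.
    cubes-bound : ∀ {s Θs} → (∀ θ τ → ν θ τ ≤ s) → AllPairs Transversal Θs →
      n * n * cubes Θs ≤ s * n * n * n * m + 2 * n * n * m * m + length Θs * m * m * m
    cubes-bound {s} {Θs} ν≤s ts = +-cancelʳ-≤ c _ _ (begin
      n * n * r + c                                                ≡⟨ left n m k s r ⟩
      n * n * r + (m * m + 2 * n * m * s) * (k * m) + s * k * n * m * m  ≤⟨ +-monoˡ-≤ (s * k * n * m * m) summed ⟩
      s * n * n * e + (s * m * m * (k * n) + 2 * n * m * e) + s * k * n * m * m  ≡⟨ middle n m k s e ⟩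
      (s * n + 2 * m) * (n * e) + 2 * s * k * n * m * m            ≤⟨ +-monoˡ-≤ (2 * s * k * n * m * m) (*-monoʳ-≤ (s * n + 2 * m) (energy-bound ts)) ⟩
      (s * n + 2 * m) * (n * n * m + k * (m * m)) + 2 * s * k * n * m * m  ≡⟨ right n m k s ⟩
      s * n * n * n * m + 2 * n * n * m * m + k * m * m * m + c    ∎)
      where
      open ≤-Reasoning
      k = length Θs
      e = energy Θs
      r = cubes Θs
      -- The terms that cancel when (s - ν)(n ν - m)² is summed and the energy bound is inserted;
      -- adding them on both sides keeps the computation in ℕ.
      c = k * m * m * m + 3 * s * k * n * m * m

      left : ∀ n m k s r → n * n * r + (k * m * m * m + 3 * s * k * n * m * m)
        ≡ n * n * r + (m * m + 2 * n * m * s) * (k * m) + s * k * n * m * m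
      left = solve-∀

      middle : ∀ n m k s e → s * n * n * e + (s * m * m * (k * n) + 2 * n * m * e) + s * k * n * m * m
        ≡ (s * n + 2 * m) * (n * e) + 2 * s * k * n * m * m
      middle = solve-∀

      right : ∀ n m k s → (s * n + 2 * m) * (n * n * m + k * (m * m)) + 2 * s * k * n * m * m
        ≡ s * n * n * n * m + 2 * n * n * m * m + k * m * m * m + (k * m * m * m + 3 * s * k * n * m * m)
      right = solve-∀

      pointwise : ∀ v → v ≤ s →
        n * n * (v * v * v) + (m * m + 2 * n * m * s) * v ≤ s * n * n * (v * v) + 1 * (2 * n * m * (v * v) + s * m * m * 1)
      -- With s = v + d, the inequality is d times (n v - m)² ≥ 0.
      pointwise v v≤s = subst (λ s → n * n * (v * v * v) + (m * m + 2 * n * m * s) * v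
          ≤ s * n * n * (v * v) + 1 * (2 * n * m * (v * v) + s * m * m * 1)) (m+[n∸m]≡n v≤s) (begin
        n * n * (v * v * v) + (m * m + 2 * n * m * (v + d)) * v
          ≡⟨ lhs n m v d ⟩
        n * n * (v * v * v) + m * m * v + 2 * n * m * v * v + d * (2 * (n * v * m))
          ≤⟨ +-monoʳ-≤ _ (*-monoʳ-≤ d (2ab≤a²+b² (n * v) m)) ⟩
        n * n * (v * v * v) + m * m * v + 2 * n * m * v * v + d * (n * v * (n * v) + m * m)
          ≡⟨ rhs n m v d ⟩
        (v + d) * n * n * (v * v) + 1 * (2 * n * m * (v * v) + (v + d) * m * m * 1) ∎)
        where
        d = s ∸ v
        lhs : ∀ n m v d → n * n * (v * v * v) + (m * m + 2 * n * m * (v + d)) * v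
          ≡ n * n * (v * v * v) + m * m * v + 2 * n * m * v * v + d * (2 * (n * v * m))
        lhs = solve-∀
        rhs : ∀ n m v d → n * n * (v * v * v) + m * m * v + 2 * n * m * v * v + d * (n * v * (n * v) + m * m)
          ≡ (v + d) * n * n * (v * v) + 1 * (2 * n * m * (v * v) + (v + d) * m * m * 1)
        rhs = solve-∀

      summed : n * n * r + (m * m + 2 * n * m * s) * (k * m) ≤ s * n * n * e + (s * m * m * (k * n) + 2 * n * m * e)
      summed = begin
        n * n * r + (m * m + 2 * n * m * s) * (k * m)
          ≡⟨ cong (λ z → n * n * r + (m * m + 2 * n * m * s) * z)
               (sym (trans (∑-cong ∑-ν Θs) (∑-const Θs m))) ⟩
        n * n * r + (m * m + 2 * n * m * s) * (∑[ θ ∈ Θs ] ∑[ τ ∈ pts ] ν θ τ)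
          ≡⟨ ∑∑Θ (n * n) (m * m + 2 * n * m * s) _ ν ⟨
        (∑[ θ ∈ Θs ] ∑[ τ ∈ pts ] n * n * (ν θ τ * ν θ τ * ν θ τ) + (m * m + 2 * n * m * s) * ν θ τ)
          ≤⟨ ∑-mono (λ θ → ∑-mono (λ τ → pointwise (ν θ τ) (ν≤s θ τ)) pts) Θs ⟩
        (∑[ θ ∈ Θs ] ∑[ τ ∈ pts ] s * n * n * (ν θ τ * ν θ τ) + 1 * (2 * n * m * (ν θ τ * ν θ τ) + s * m * m * 1))
          ≡⟨ trans (∑∑Θ (s * n * n) 1 _ _) (cong (λ z → s * n * n * e + 1 * z) (trans (∑∑Θ (2 * n * m) (s * m * m) _ (λ _ _ → 1))
               (cong (λ z → 2 * n * m * e + s * m * m * z)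
                 (trans (∑-cong (λ _ → sym (length≡∑1 pts)) Θs) (∑-const Θs n))))) ⟩
        s * n * n * e + 1 * (2 * n * m * e + s * m * m * (k * n))
          ≡⟨ final (s * n * n * e) (2 * n * m * e) (s * m * m * (k * n)) ⟩
        s * n * n * e + (s * m * m * (k * n) + 2 * n * m * e) ∎
        where
        ∑∑Θ : ∀ a b (g h : Θ → P → ℕ) → (∑[ θ ∈ Θs ] ∑[ τ ∈ pts ] a * g θ τ + b * h θ τ)
          ≡ a * (∑[ θ ∈ Θs ] ∑[ τ ∈ pts ] g θ τ) + b * (∑[ θ ∈ Θs ] ∑[ τ ∈ pts ] h θ τ)
        ∑∑Θ a b g h = trans (∑-cong (λ θ → ∑-linear pts a b (g θ) (h θ)) Θs)
          (∑-linear Θs a b (λ θ → ∑ pts (g θ)) (λ θ → ∑ pts (h θ)))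
        final : ∀ a b c → a + 1 * (b + c) ≡ a + (c + b)
        final = solve-∀

-- Cauchy-Schwarz over equivalence classes

module Classes {A : Set} {_≈_ : Rel A 0ℓ} (_≈?_ : Binary.Decidable _≈_) (≈-isEquivalence : IsEquivalence _≈_) where

  open IsEquivalence ≈-isEquivalence using () renaming (refl to ≈-refl; sym to ≈-sym; trans to ≈-trans)

  decSetoid : DecSetoid 0ℓ 0ℓ
  decSetoid = record { isDecEquivalence = record { isEquivalence = ≈-isEquivalence ; _≟_ = _≈?_ } }

  private
    at-most-one : ∀ {rs} s → AllPairs (λ r r′ → ¬ r ≈ r′) rs → (∑[ r ∈ rs ] ⟦ r ≈? s ⟧) ℕ.≤ 1
    at-most-one s [] = ℕ.z≤n
    at-most-one s (_∷_ {x = r} {xs = rs} r≉ distinct) with r ≈? s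
    ... | no _    = at-most-one s distinct
    ... | yes r≈s = ℕ.≤-reflexive (cong suc (others r≉))
      where
      others : ∀ {rs} → All (λ r′ → ¬ r ≈ r′) rs → (∑[ r′ ∈ rs ] ⟦ r′ ≈? s ⟧) ≡ 0
      others [] = refl
      others {r′ ∷ _} (r≉r′ ∷ rest)
        rewrite ⟦⟧-false (r′ ≈? s) (λ r′≈s → r≉r′ (≈-trans r≈s (≈-sym r′≈s))) = others rest

    -- A representative equivalent to both s and t forces s and t to be equivalent, and pairwise
    -- inequivalent representatives leave room for only one.
    common : ∀ {rs} s t → AllPairs (λ r r′ → ¬ r ≈ r′) rs →
      (∑[ r ∈ rs ] ⟦ r ≈? s ⟧ ℕ.* ⟦ r ≈? t ⟧) ℕ.≤ ⟦ s ≈? t ⟧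
    common {rs} s t distinct with s ≈? t
    ... | yes _ = ℕ.≤-trans (∑-mono (λ r → ℕ.≤-trans (ℕ.*-monoʳ-≤ ⟦ r ≈? s ⟧ (⟦⟧≤1 (r ≈? t)))
        (ℕ.≤-reflexive (ℕ.*-identityʳ ⟦ r ≈? s ⟧))) rs) (at-most-one s distinct)
    ... | no s≉t = ℕ.≤-reflexive (trans (∑-cong never rs) (trans (∑-const rs 0) (ℕ.*-zeroʳ (length rs))))
      where
      never : ∀ r → ⟦ r ≈? s ⟧ ℕ.* ⟦ r ≈? t ⟧ ≡ 0
      never r with r ≈? s | r ≈? t
      ... | no _    | _       = refl
      ... | yes _   | no _    = refl
      ... | yes r≈s | yes r≈t = contradiction (≈-trans (≈-sym r≈s) r≈t) s≉t

  -- The class sizes add up to at least the length, and their squares add up to at most the number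
  -- of equivalent pairs, since the two members of such a pair are counted only in their common
  -- class.
  length²≤classes*pairs : ∀ xs →
    length xs ℕ.* length xs ℕ.≤ length (deduplicate _≈?_ xs) ℕ.* (∑[ s ∈ xs ] ∑[ t ∈ xs ] ⟦ s ≈? t ⟧)
  length²≤classes*pairs xs = begin
    length xs ℕ.* length xs             ≤⟨ ℕ.*-mono-≤ covered covered ⟩
    ∑ rs size ℕ.* ∑ rs size             ≤⟨ ∑-cauchy rs size ⟩
    length rs ℕ.* (∑[ r ∈ rs ] size r ℕ.* size r)
      ≤⟨ ℕ.*-monoʳ-≤ (length rs) (begin
        (∑[ r ∈ rs ] size r ℕ.* size r)
          ≡⟨ ∑-cong (λ r → sym (∑-product xs xs _ _)) rs ⟩
        (∑[ r ∈ rs ] ∑[ s ∈ xs ] ∑[ t ∈ xs ] ⟦ r ≈? s ⟧ ℕ.* ⟦ r ≈? t ⟧)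
          ≡⟨ trans (∑-swap rs xs _) (∑-cong (λ s → ∑-swap rs xs _) xs) ⟩
        (∑[ s ∈ xs ] ∑[ t ∈ xs ] ∑[ r ∈ rs ] ⟦ r ≈? s ⟧ ℕ.* ⟦ r ≈? t ⟧)
          ≤⟨ ∑-mono (λ s → ∑-mono (λ t → common s t (deduplicate-! decSetoid xs)) xs) xs ⟩
        (∑[ s ∈ xs ] ∑[ t ∈ xs ] ⟦ s ≈? t ⟧) ∎) ⟩
    length rs ℕ.* (∑[ s ∈ xs ] ∑[ t ∈ xs ] ⟦ s ≈? t ⟧) ∎
    where
    open ℕ.≤-Reasoning
    rs = deduplicate _≈?_ xs
    size : A → ℕ
    size r = ∑[ t ∈ xs ] ⟦ r ≈? t ⟧

    represented : ∀ {t} → t ∈ xs → 1 ℕ.≤ (∑[ r ∈ rs ] ⟦ r ≈? t ⟧)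
    represented {t} t∈xs with find (Any.deduplicate⁺ _≈?_ {P = _≈ t} ≈-trans (Any.map (λ {refl → ≈-refl}) t∈xs))
    ... | r , r∈rs , r≈t = ℕ.≤-trans (ℕ.≤-reflexive (sym (⟦⟧-true (r ≈? t) r≈t))) (∈⇒≤∑ (λ r → ⟦ r ≈? t ⟧) r∈rs)

    covered : length xs ℕ.≤ ∑ rs size
    covered = begin
      length xs                                 ≡⟨ length≡∑1 xs ⟩
      (∑[ t ∈ xs ] 1)                           ≤⟨ ∑-mono-∈ xs represented ⟩
      (∑[ t ∈ xs ] ∑[ r ∈ rs ] ⟦ r ≈? t ⟧)      ≡⟨ ∑-swap xs rs _ ⟩
      ∑ rs size                                 ∎

-- Plane geometry over a ring

module IntegerCoefficients {c ℓ} (R : CommutativeRing c ℓ) where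

  open CommutativeRing R renaming (refl to ≈-refl; sym to ≈-sym; trans to ≈-trans)
  open SemiringMult semiring using (×-homo-+; ×1-homo-*) renaming (_×_ to _⋆_)
  open AbelianGroupProperties +-abelianGroup using (⁻¹-∙-comm; ⁻¹-involutive; ε⁻¹≈ε)
  open RingProperties ring using (-‿distribˡ-*; -‿distribʳ-*)
  open import Relation.Binary.Reasoning.Setoid setoid

  -- Integer coefficients give the ring solver a decidable coefficient ring over any commutative
  -- ring. The optimised multiple makes the constants 0 and 1 evaluate definitionally to `0#` and
  -- `1#`.
  ⟦_⟧ᶻ : ℤ → Carrier
  ⟦ ℤ.+ n ⟧ᶻ    = n ⋆ 1#
  ⟦ -[1+ n ] ⟧ᶻ = - (suc n ⋆ 1#)

  private
    suc-homo : ∀ n → suc n ⋆ 1# ≈ 1# + n ⋆ 1#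
    suc-homo n = ×-homo-+ 1# 1 n

    -‿homo : ∀ i → ⟦ ℤ.- i ⟧ᶻ ≈ - ⟦ i ⟧ᶻ
    -‿homo (ℤ.+ zero)  = ≈-sym ε⁻¹≈ε
    -‿homo (ℤ.+ suc n) = ≈-refl
    -‿homo -[1+ n ]    = ≈-sym (⁻¹-involutive _)

    ⊖-homo : ∀ m n → ⟦ m ℤ.⊖ n ⟧ᶻ ≈ m ⋆ 1# - n ⋆ 1#
    ⊖-homo m       zero    = ≈-sym (≈-trans (+-congˡ ε⁻¹≈ε) (+-identityʳ _))
    ⊖-homo zero    (suc n) = ≈-sym (+-identityˡ _)
    ⊖-homo (suc m) (suc n) = begin
      ⟦ suc m ℤ.⊖ suc n ⟧ᶻ                 ≡⟨ cong ⟦_⟧ᶻ (ℤ.[1+m]⊖[1+n]≡m⊖n m n) ⟩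
      ⟦ m ℤ.⊖ n ⟧ᶻ                         ≈⟨ ⊖-homo m n ⟩
      m ⋆ 1# - n ⋆ 1#                      ≈⟨ +-congʳ (≈-sym (≈-trans (+-congʳ (-‿inverseʳ 1#)) (+-identityˡ _))) ⟩
      1# - 1# + m ⋆ 1# - n ⋆ 1#            ≈⟨ +-congʳ (≈-trans (+-assoc _ _ _) (≈-trans (+-congˡ (+-comm _ _)) (≈-sym (+-assoc _ _ _)))) ⟩
      1# + m ⋆ 1# - 1# - n ⋆ 1#            ≈⟨ +-assoc _ _ _ ⟩
      1# + m ⋆ 1# + (- 1# - n ⋆ 1#)        ≈⟨ +-cong (≈-sym (suc-homo m)) (≈-trans (⁻¹-∙-comm _ _) (-‿cong (≈-sym (suc-homo n)))) ⟩
      suc m ⋆ 1# - suc n ⋆ 1#              ∎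

    +-homo : ∀ i j → ⟦ i ℤ.+ j ⟧ᶻ ≈ ⟦ i ⟧ᶻ + ⟦ j ⟧ᶻ
    +-homo (ℤ.+ m)    (ℤ.+ n)    = ×-homo-+ 1# m n
    +-homo (ℤ.+ m)    -[1+ n ]   = ⊖-homo m (suc n)
    +-homo -[1+ m ]   (ℤ.+ n)    = ≈-trans (⊖-homo n (suc m)) (+-comm _ _)
    +-homo -[1+ m ]   -[1+ n ]   = ≈-trans
      (-‿cong (≈-trans (reflexive (cong (λ k → suc k ⋆ 1#) (sym (ℕ.+-suc m n)))) (×-homo-+ 1# (suc m) (suc n))))
      (≈-sym (⁻¹-∙-comm _ _))

    +*-homo : ∀ m j → ⟦ ℤ.+ m ℤ.* j ⟧ᶻ ≈ m ⋆ 1# * ⟦ j ⟧ᶻ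
    +*-homo m (ℤ.+ n)  = ≈-trans (reflexive (cong ⟦_⟧ᶻ (sym (ℤ.pos-* m n)))) (×1-homo-* m n)
    +*-homo m -[1+ n ] = begin
      ⟦ ℤ.+ m ℤ.* ℤ.- ℤ.+ suc n ⟧ᶻ       ≡⟨ cong ⟦_⟧ᶻ (ℤ.neg-distribʳ-* (ℤ.+ m) (ℤ.+ suc n)) ⟨
      ⟦ ℤ.- (ℤ.+ m ℤ.* ℤ.+ suc n) ⟧ᶻ     ≈⟨ -‿homo (ℤ.+ m ℤ.* ℤ.+ suc n) ⟩
      - ⟦ ℤ.+ m ℤ.* ℤ.+ suc n ⟧ᶻ         ≈⟨ -‿cong (+*-homo m (ℤ.+ suc n)) ⟩
      - (m ⋆ 1# * suc n ⋆ 1#)            ≈⟨ -‿distribʳ-* (m ⋆ 1#) (suc n ⋆ 1#) ⟩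
      m ⋆ 1# * - (suc n ⋆ 1#)            ∎

    *-homo : ∀ i j → ⟦ i ℤ.* j ⟧ᶻ ≈ ⟦ i ⟧ᶻ * ⟦ j ⟧ᶻ
    *-homo (ℤ.+ m)  j = +*-homo m j
    *-homo -[1+ m ] j = begin
      ⟦ ℤ.- ℤ.+ suc m ℤ.* j ⟧ᶻ     ≡⟨ cong ⟦_⟧ᶻ (ℤ.neg-distribˡ-* (ℤ.+ suc m) j) ⟨
      ⟦ ℤ.- (ℤ.+ suc m ℤ.* j) ⟧ᶻ   ≈⟨ -‿homo (ℤ.+ suc m ℤ.* j) ⟩
      - ⟦ ℤ.+ suc m ℤ.* j ⟧ᶻ       ≈⟨ -‿cong (+*-homo (suc m) j) ⟩
      - (suc m ⋆ 1# * ⟦ j ⟧ᶻ)      ≈⟨ -‿distribˡ-* (suc m ⋆ 1#) ⟦ j ⟧ᶻ ⟩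
      - (suc m ⋆ 1#) * ⟦ j ⟧ᶻ      ∎

    ℤ⟶R : CommutativeRing.rawRing ℤ.+-*-commutativeRing -Raw-AlmostCommutative⟶ fromCommutativeRing R
    ℤ⟶R = record
      { ⟦_⟧    = ⟦_⟧ᶻ
      ; +-homo = +-homo
      ; *-homo = *-homo
      ; -‿homo = -‿homo
      ; 0-homo = ≈-refl
      ; 1-homo = ≈-refl
      }

  open RingSolver _ _ ℤ⟶R
    (λ i j → Maybe.map (λ i≡j → reflexive (cong ⟦_⟧ᶻ i≡j)) (dec⇒maybe (i ℤ.≟ j))) public
    using (solve; con; _:+_; _:*_; _:-_; :-_; _:=_)

module RingIdentities {A : Set} {_+_ _*_ : Op₂ A} { -_ : Op₁ A} {0# 1# : A}
  (isCommutativeRing : IsCommutativeRing _≡_ _+_ _*_ -_ 0# 1#) where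

  commutativeRing : CommutativeRing _ _
  commutativeRing = record { isCommutativeRing = isCommutativeRing }

  private
    module R = CommutativeRing commutativeRing

  open IntegerCoefficients commutativeRing
  open RingProperties R.ring using (x∙y⁻¹≈ε⇒x≈y; [y-z]x≈yx-zx)

  infixl 6 _-_
  _-_ : Op₂ A
  a - b = a + (- b)

  difference-zero : ∀ {a b} → a ≡ b → a - b ≡ 0#
  difference-zero {a} refl = R.-‿inverseʳ a

  zero-difference : ∀ {a b} → a - b ≡ 0# → a ≡ b
  zero-difference = x∙y⁻¹≈ε⇒x≈y _ _

  -1≡0⇒1≡0 : - 1# ≡ 0# → 1# ≡ 0#
  -1≡0⇒1≡0 eq = trans (solve 0 (con (ℤ.+ 1) := :- (:- con (ℤ.+ 1))) refl)
    (trans (cong -_ eq) (solve 0 (:- con (ℤ.+ 0) := con (ℤ.+ 0)) refl))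

  a≡-a⇒a+a≡0 : ∀ {a} → a ≡ - a → a + a ≡ 0#
  a≡-a⇒a+a≡0 {a} eq = trans (cong (a +_) eq) (R.-‿inverseʳ a)

  [-1]²≡1 : (- 1#) * ((- 1#) * 1#) ≡ 1#
  [-1]²≡1 = solve 0 ((:- con (ℤ.+ 1)) :* ((:- con (ℤ.+ 1)) :* con (ℤ.+ 1)) := con (ℤ.+ 1)) refl

  a+b≡c⇒b≡c-a : ∀ {a b c} → a + b ≡ c → b ≡ c - a
  a+b≡c⇒b≡c-a {a} {b} refl = solve 2 (λ a b → b := a :+ b :- a) refl a b

  1+ya≡0⇒[-y]a≡1 : ∀ y a → 1# + (y * a) ≡ 0# → (- y) * a ≡ 1#
  1+ya≡0⇒[-y]a≡1 y a eq = trans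
    (solve 2 (λ y a → (:- y) :* a := con (ℤ.+ 1) :- (con (ℤ.+ 1) :+ y :* a)) refl y a)
    (trans (cong (λ z → 1# - z) eq) (solve 0 (con (ℤ.+ 1) :- con (ℤ.+ 0) := con (ℤ.+ 1)) refl))

  -- Points of the plane are pairs; rotate (a , b) is multiplication by
  -- a + b i and conj is complex conjugation.

  Pt : Set
  Pt = A × A

  norm : Pt → A
  norm (a , b) = (a * a) + (b * b)

  conj : Pt → Pt
  conj (x₁ , x₂) = x₁ , - x₂

  conj↔ : Pt ↔ Pt
  conj↔ = mk↔ₛ′ conj conj involutive involutive
    where
    involutive : ∀ x → conj (conj x) ≡ x
    involutive (x₁ , x₂) = cong (x₁ ,_) (solve 1 (λ x → :- (:- x) := x) refl x₂)

  rotate : Pt → Pt → Pt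
  rotate (a , b) (x₁ , x₂) = (a * x₁) + ((- b) * x₂) , (b * x₁) + (a * x₂)

  _⊞_ _⊟_ : Pt → Pt → Pt
  (x₁ , x₂) ⊞ (y₁ , y₂) = x₁ + y₁ , x₂ + y₂
  (x₁ , x₂) ⊟ (y₁ , y₂) = x₁ - y₁ , x₂ - y₂

  translate : Pt → Pt ↔ Pt
  translate z = mk↔ₛ′ (_⊟ z) (_⊞ z)
    (λ (x₁ , x₂) → cong₂ _,_ (plus-minus x₁ _) (plus-minus x₂ _))
    (λ (x₁ , x₂) → cong₂ _,_ (minus-plus x₁ _) (minus-plus x₂ _))
    where
    plus-minus : ∀ a b → (a + b) - b ≡ a
    plus-minus = solve 2 (λ a b → a :+ b :- b := a) refl
    minus-plus : ∀ a b → (a - b) + b ≡ a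
    minus-plus = solve 2 (λ a b → a :- b :+ b := a) refl

  -- The label of (x , y) in the class of z is the τ with y = z x + τ.
  label : Pt → Pt → Pt ↔ Pt
  label z x = translate (rotate z x)

  label-at : Pt → Pt → Pt → Pt → Pt
  label-at z z′ τ x = Inverse.to (label z′ x) (Inverse.from (label z x) τ)

  label-at-rotate : ∀ z z′ τ x → rotate (z ⊟ z′) x ⊞ τ ≡ label-at z z′ τ x
  label-at-rotate (a , b) (a′ , b′) (τ₁ , τ₂) (x₁ , x₂) = cong₂ _,_
    (solve 7 (λ a b a′ b′ t x₁ x₂ → (a :- a′) :* x₁ :+ (:- (b :- b′)) :* x₂ :+ t
      := t :+ (a :* x₁ :+ (:- b) :* x₂) :- (a′ :* x₁ :+ (:- b′) :* x₂)) refl a b a′ b′ τ₁ x₁ x₂)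
    (solve 7 (λ a b a′ b′ t x₁ x₂ → (b :- b′) :* x₁ :+ (a :- a′) :* x₂ :+ t
      := t :+ (b :* x₁ :+ a :* x₂) :- (b′ :* x₁ :+ a′ :* x₂)) refl a b a′ b′ τ₂ x₁ x₂)

  -- As in the complex numbers, w times its conjugate is `norm w`, so multiplication by w is undone
  -- by multiplication by k times the conjugate.
  affine↔ : ∀ w {k} → k * norm w ≡ 1# → Pt → Pt ↔ Pt
  affine↔ w@(u , v) {k} kN≡1 τ@(τ₁ , τ₂) = mk↔ₛ′ (λ x → rotate w x ⊞ τ) (λ y → rotate w⁻¹ (y ⊟ τ))
    (λ (y₁ , y₂) → cong₂ _,_
      (trans (solve 6 (λ k u v s y₁ y₂ → u :* (k :* u :* y₁ :+ (:- (:- (k :* v))) :* y₂) :+ (:- v) :* ((:- (k :* v)) :* y₁ :+ k :* u :* y₂) :+ s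
          := k :* (u :* u :+ v :* v) :* y₁ :+ s) refl k u v τ₁ (y₁ - τ₁) (y₂ - τ₂)) (restore y₁ τ₁))
      (trans (solve 6 (λ k u v s y₁ y₂ → v :* (k :* u :* y₁ :+ (:- (:- (k :* v))) :* y₂) :+ u :* ((:- (k :* v)) :* y₁ :+ k :* u :* y₂) :+ s
          := k :* (u :* u :+ v :* v) :* y₂ :+ s) refl k u v τ₂ (y₁ - τ₁) (y₂ - τ₂)) (restore y₂ τ₂)))
    (λ (x₁ , x₂) → cong₂ _,_
      (trans (solve 7 (λ k u v s t x₁ x₂ →
          k :* u :* (u :* x₁ :+ (:- v) :* x₂ :+ s :- s) :+ (:- (:- (k :* v))) :* (v :* x₁ :+ u :* x₂ :+ t :- t)
          := k :* (u :* u :+ v :* v) :* x₁) refl k u v τ₁ τ₂ x₁ x₂) (drop x₁))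
      (trans (solve 7 (λ k u v s t x₁ x₂ →
          (:- (k :* v)) :* (u :* x₁ :+ (:- v) :* x₂ :+ s :- s) :+ k :* u :* (v :* x₁ :+ u :* x₂ :+ t :- t)
          := k :* (u :* u :+ v :* v) :* x₂) refl k u v τ₁ τ₂ x₁ x₂) (drop x₂)))
    where
    w⁻¹ : Pt
    w⁻¹ = k * u , - (k * v)
    drop : ∀ x → (k * norm w) * x ≡ x
    drop x = trans (cong (_* x) kN≡1) (R.*-identityˡ x)
    restore : ∀ y t → ((k * norm w) * (y - t)) + t ≡ y
    restore y t = trans (cong (_+ t) (drop (y - t))) (solve 2 (λ y t → y :- t :+ t := y) refl y t)

  -- (a , c) and (b , d) are the columns of an orthogonal matrix ((a , b) , (c , d)).
  module Orthonormal {a b c d} (aa+cc : (a * a) + (c * c) ≡ 1#)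
    (ab+cd : (a * b) + (c * d) ≡ 0#) (bb+dd : (b * b) + (d * d) ≡ 1#) where

    det : A
    det = (a * d) - (b * c)

    -- Lagrange's identity: the squared determinant is the product of the squared norms of the
    -- columns minus the square of their dot product.
    det² : det * det ≡ 1#
    det² = trans
      (solve 4 (λ a b c d → (a :* d :- b :* c) :* (a :* d :- b :* c)
        := (a :* a :+ c :* c) :* (b :* b :+ d :* d) :- (a :* b :+ c :* d) :* (a :* b :+ c :* d)) refl a b c d)
      (trans (cong₂ (λ x y → (x * y) - (((a * b) + (c * d)) * ((a * b) + (c * d)))) aa+cc bb+dd)
      (trans (cong (λ x → (1# * 1#) - (x * x)) ab+cd)
        (solve 0 (con (ℤ.+ 1) :* con (ℤ.+ 1) :- con (ℤ.+ 0) :* con (ℤ.+ 0) := con (ℤ.+ 1)) refl)))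

    -- With `d≡`, this says that the second column is `det` times the quarter turn of the first. The
    -- rotation and reflection forms and the orthonormality of the rows all follow from it and
    -- `det²`.
    b≡ : b ≡ - (det * c)
    b≡ = trans (sym (R.*-identityˡ b)) (trans (cong (_* b) (sym aa+cc)) (trans
      (solve 4 (λ a b c d → (a :* a :+ c :* c) :* b := a :* (a :* b :+ c :* d) :+ (:- ((a :* d :- b :* c) :* c))) refl a b c d)
      (trans (cong (λ x → (a * x) + (- (det * c))) ab+cd)
        (solve 2 (λ a z → a :* con (ℤ.+ 0) :+ z := z) refl a (- (det * c))))))

    d≡ : d ≡ det * a
    d≡ = trans (sym (R.*-identityˡ d)) (trans (cong (_* d) (sym aa+cc)) (trans
      (solve 4 (λ a b c d → (a :* a :+ c :* c) :* d := c :* (a :* b :+ c :* d) :+ (a :* d :- b :* c) :* a) refl a b c d)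
      (trans (cong (λ x → (c * x) + (det * a)) ab+cd)
        (solve 2 (λ c z → c :* con (ℤ.+ 0) :+ z := z) refl c (det * a)))))

    aa+bb : (a * a) + (b * b) ≡ 1#
    aa+bb = trans (cong (λ x → (a * a) + (x * x)) b≡) (trans
      (solve 3 (λ a c e → a :* a :+ (:- (e :* c)) :* (:- (e :* c)) := a :* a :+ e :* e :* (c :* c)) refl a c det)
      (trans (cong (λ x → (a * a) + (x * (c * c))) det²) (trans (cong ((a * a) +_) (R.*-identityˡ (c * c))) aa+cc)))

    cc+dd : (c * c) + (d * d) ≡ 1#
    cc+dd = trans (cong (λ x → (c * c) + (x * x)) d≡) (trans
      (solve 3 (λ a c e → c :* c :+ e :* a :* (e :* a) := e :* e :* (a :* a) :+ c :* c) refl a c det)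
      (trans (cong (λ x → (x * (a * a)) + (c * c)) det²) (trans (cong (_+ (c * c)) (R.*-identityˡ (a * a))) aa+cc)))

    ac+bd : (a * c) + (b * d) ≡ 0#
    ac+bd = trans (cong₂ (λ x y → (a * c) + (x * y)) b≡ d≡) (trans
      (solve 3 (λ a c e → a :* c :+ (:- (e :* c)) :* (e :* a) := (con (ℤ.+ 1) :- e :* e) :* (a :* c)) refl a c det)
      (trans (cong (λ x → (1# - x) * (a * c)) det²)
        (solve 1 (λ z → (con (ℤ.+ 1) :- con (ℤ.+ 1)) :* z := con (ℤ.+ 0)) refl (a * c))))

    dot-preserved : ∀ x₁ x₂ y₁ y₂ →
      (((a * x₁) + (b * x₂)) * ((a * y₁) + (b * y₂))) + (((c * x₁) + (d * x₂)) * ((c * y₁) + (d * y₂)))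
        ≡ (x₁ * y₁) + (x₂ * y₂)
    dot-preserved x₁ x₂ y₁ y₂ = trans
      (solve 8 (λ a b c d x₁ x₂ y₁ y₂ →
        (a :* x₁ :+ b :* x₂) :* (a :* y₁ :+ b :* y₂) :+ (c :* x₁ :+ d :* x₂) :* (c :* y₁ :+ d :* y₂)
          := (a :* a :+ c :* c) :* (x₁ :* y₁) :+ (b :* b :+ d :* d) :* (x₂ :* y₂)
             :+ (a :* b :+ c :* d) :* (x₁ :* y₂ :+ x₂ :* y₁)) refl a b c d x₁ x₂ y₁ y₂)
      (trans (cong₂ (λ p r → ((p * (x₁ * y₁)) + (r * (x₂ * y₂))) + (((a * b) + (c * d)) * ((x₁ * y₂) + (x₂ * y₁)))) aa+cc bb+dd)
      (trans (cong (λ z → ((1# * (x₁ * y₁)) + (1# * (x₂ * y₂))) + (z * ((x₁ * y₂) + (x₂ * y₁)))) ab+cd)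
        (solve 3 (λ x y z → con (ℤ.+ 1) :* x :+ con (ℤ.+ 1) :* y :+ con (ℤ.+ 0) :* z := x :+ y) refl _ _ _)))

    rotation : det ≡ 1# → ∀ x₁ x₂ → ((a * x₁) + (b * x₂) , (c * x₁) + (d * x₂)) ≡ rotate (a , c) (x₁ , x₂)
    rotation det≡1 x₁ x₂ = cong₂ _,_
      (cong (λ b → (a * x₁) + (b * x₂)) (trans b≡ (cong -_ (trans (cong (_* c) det≡1) (R.*-identityˡ c)))))
      (cong (λ d → (c * x₁) + (d * x₂)) (trans d≡ (trans (cong (_* a) det≡1) (R.*-identityˡ a))))

    reflection : det ≡ - 1# → ∀ x₁ x₂ → ((a * x₁) + (b * x₂) , (c * x₁) + (d * x₂)) ≡ rotate (a , c) (conj (x₁ , x₂))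
    reflection det≡-1 x₁ x₂ = cong₂ _,_
      (trans (cong (λ b → (a * x₁) + (b * x₂)) (trans b≡ (cong (λ e → - (e * c)) det≡-1)))
        (solve 4 (λ a c x₁ x₂ → a :* x₁ :+ (:- ((:- con (ℤ.+ 1)) :* c)) :* x₂ := a :* x₁ :+ (:- c) :* (:- x₂)) refl a c x₁ x₂))
      (trans (cong (λ d → (c * x₁) + (d * x₂)) (trans d≡ (cong (_* a) det≡-1)))
        (solve 4 (λ a c x₁ x₂ → c :* x₁ :+ ((:- con (ℤ.+ 1)) :* a) :* x₂ := c :* x₁ :+ a :* (:- x₂)) refl a c x₁ x₂))

    transpose-inverse₁ : ∀ x₁ x₂ τ₁ τ₂ →
      x₁ ≡ ((a * (((a * x₁) + (b * x₂)) + τ₁)) + (c * (((c * x₁) + (d * x₂)) + τ₂))) + (- ((a * τ₁) + (c * τ₂)))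
    transpose-inverse₁ x₁ x₂ τ₁ τ₂ = sym (trans
      (solve 8 (λ a b c d x₁ x₂ s t →
        a :* (a :* x₁ :+ b :* x₂ :+ s) :+ c :* (c :* x₁ :+ d :* x₂ :+ t) :+ (:- (a :* s :+ c :* t))
          := (a :* a :+ c :* c) :* x₁ :+ (a :* b :+ c :* d) :* x₂) refl a b c d x₁ x₂ τ₁ τ₂)
      (trans (cong₂ (λ p r → (p * x₁) + (r * x₂)) aa+cc ab+cd)
        (solve 2 (λ x y → con (ℤ.+ 1) :* x :+ con (ℤ.+ 0) :* y := x) refl x₁ x₂)))

    transpose-inverse₂ : ∀ x₁ x₂ τ₁ τ₂ →
      x₂ ≡ ((b * (((a * x₁) + (b * x₂)) + τ₁)) + (d * (((c * x₁) + (d * x₂)) + τ₂))) + (- ((b * τ₁) + (d * τ₂)))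
    transpose-inverse₂ x₁ x₂ τ₁ τ₂ = sym (trans
      (solve 8 (λ a b c d x₁ x₂ s t →
        b :* (a :* x₁ :+ b :* x₂ :+ s) :+ d :* (c :* x₁ :+ d :* x₂ :+ t) :+ (:- (b :* s :+ d :* t))
          := (a :* b :+ c :* d) :* x₁ :+ (b :* b :+ d :* d) :* x₂) refl a b c d x₁ x₂ τ₁ τ₂)
      (trans (cong₂ (λ p r → (p * x₁) + (r * x₂)) ab+cd bb+dd)
        (solve 2 (λ x y → con (ℤ.+ 0) :* x :+ con (ℤ.+ 1) :* y := y) refl x₁ x₂)))

  -- One coordinate of (A B) x + (A σ + τ) = A (B x + σ) + τ.
  compose-coordinate : ∀ a b a′ b′ c′ d′ x₁ x₂ σ₁ σ₂ τ →
    ((a * (((a′ * x₁) + (b′ * x₂)) + σ₁)) + (b * (((c′ * x₁) + (d′ * x₂)) + σ₂))) + τ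
      ≡ ((((a * a′) + (b * c′)) * x₁) + (((a * b′) + (b * d′)) * x₂)) + (((a * σ₁) + (b * σ₂)) + τ)
  compose-coordinate = solve 11 (λ a b a′ b′ c′ d′ x₁ x₂ s t u →
    a :* (a′ :* x₁ :+ b′ :* x₂ :+ s) :+ b :* (c′ :* x₁ :+ d′ :* x₂ :+ t) :+ u
      := (a :* a′ :+ b :* c′) :* x₁ :+ (a :* b′ :+ b :* d′) :* x₂ :+ (a :* s :+ b :* t :+ u)) refl

  identity-coordinate₁ : ∀ x y → x ≡ ((1# * x) + (0# * y)) + 0#
  identity-coordinate₁ x y = solve 2 (λ x y → x := con (ℤ.+ 1) :* x :+ con (ℤ.+ 0) :* y :+ con (ℤ.+ 0)) refl x y

  identity-coordinate₂ : ∀ x y → y ≡ ((0# * x) + (1# * y)) + 0#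
  identity-coordinate₂ x y = solve 2 (λ x y → y := con (ℤ.+ 0) :* x :+ con (ℤ.+ 1) :* y :+ con (ℤ.+ 0)) refl x y

  identity-column : ((1# * 1#) + (0# * 0#) ≡ 1#) × ((1# * 0#) + (0# * 1#) ≡ 0#)
    × ((0# * 1#) + (1# * 0#) ≡ 0#) × ((0# * 0#) + (1# * 1#) ≡ 1#)
  identity-column = solve 0 (one :* one :+ nil :* nil := one) refl , solve 0 (one :* nil :+ nil :* one := nil) refl
    , solve 0 (nil :* one :+ one :* nil := nil) refl , solve 0 (nil :* nil :+ one :* one := one) refl
    where
    one = con (ℤ.+ 1)
    nil = con (ℤ.+ 0)

  module Field (_≟_ : DecidableEquality A)
    (no-zero-divisors : ∀ a b → a * b ≡ 0# → a ≡ 0# ⊎ b ≡ 0#)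
    (inverse : ∀ a → a ≢ 0# → ∃[ b ] b * a ≡ 1#) where

    *-nonzero : ∀ {a b} → a ≢ 0# → b ≢ 0# → a * b ≢ 0#
    *-nonzero a≢0 b≢0 ab≡0 = [ a≢0 , b≢0 ]′ (no-zero-divisors _ _ ab≡0)

    *-cancelʳ-nonzero : ∀ {a b c} → c ≢ 0# → a * c ≡ b * c → a ≡ b
    *-cancelʳ-nonzero {a} {b} {c} c≢0 ac≡bc
      with no-zero-divisors (a - b) c (trans ([y-z]x≈yx-zx c a b) (difference-zero ac≡bc))
    ... | inj₁ a-b≡0 = zero-difference a-b≡0
    ... | inj₂ c≡0   = contradiction c≡0 c≢0

    equal-squares : ∀ {a b} → a * a ≡ b * b → a ≡ b ⊎ a ≡ - b
    equal-squares {a} {b} aa≡bb with no-zero-divisors (a - b) (a - (- b)) (trans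
      (solve 2 (λ a b → (a :- b) :* (a :- (:- b)) := a :* a :- b :* b) refl a b) (difference-zero aa≡bb))
    ... | inj₁ a-b≡0 = inj₁ (zero-difference a-b≡0)
    ... | inj₂ a+b≡0 = inj₂ (zero-difference a+b≡0)

    det≡±1 : ∀ {e} → e * e ≡ 1# → e ≡ 1# ⊎ e ≡ - 1#
    det≡±1 ee≡1 = equal-squares (trans ee≡1 (sym (R.*-identityˡ 1#)))

    module Anisotropic (-1-nonsquare : ∀ u → u * u ≢ - 1#) where

      -- A zero of a² + b² with b ≠ 0 would make (a / b)² = -1; with b = 0 it forces a = 0.
      norm-nonzero : ∀ w → w ≢ (0# , 0#) → norm w ≢ 0#
      norm-nonzero (a , b) w≢0 N≡0 with b ≟ 0#
      ... | yes refl with no-zero-divisors a a (trans (solve 1 (λ a → a :* a := a :* a :+ con (ℤ.+ 0) :* con (ℤ.+ 0)) refl a) N≡0)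
      ...   | inj₁ refl = w≢0 refl
      ...   | inj₂ refl = w≢0 refl
      norm-nonzero (a , b) w≢0 N≡0 | no b≢0 with inverse b b≢0
      ...   | k , kb≡1 = -1-nonsquare (a * k) (trans
        (solve 3 (λ a b k → a :* k :* (a :* k) := (a :* a :+ b :* b) :* (k :* k) :- k :* b :* (k :* b)) refl a b k)
        (trans (cong₂ (λ x y → (x * (k * k)) - (y * y)) N≡0 kb≡1)
          (solve 1 (λ z → con (ℤ.+ 0) :* z :- con (ℤ.+ 1) :* con (ℤ.+ 1) := :- con (ℤ.+ 1)) refl (k * k))))

      -- Along the plane y = zx + τ the label for z′ is (z - z′) x + τ, an affine bijection in x
      -- because z - z′ has nonzero norm.
      label-transversal : ∀ {z z′} → z ≢ z′ → ∀ τ → Σ[ φ ∈ (Pt ↔ Pt) ] (∀ x → Inverse.to φ x ≡ label-at z z′ τ x)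
      label-transversal {z} {z′} z≢z′ τ = affine↔ (z ⊟ z′) (proj₂ (inverse (norm (z ⊟ z′)) N≢0)) τ , label-at-rotate z z′ τ
        where
        N≢0 : norm (z ⊟ z′) ≢ 0#
        N≢0 = norm-nonzero (z ⊟ z′) (λ eq → z≢z′ (cong₂ _,_ (zero-difference (cong proj₁ eq)) (zero-difference (cong proj₂ eq))))

-- The field with q elements

module ModularRing (q : ℕ) .{{q≢0 : NonZero q}} where

  [_] : ℕ → F q
  [ n ] = n mod q

  toℕ-[] : ∀ n → toℕ [ n ] ≡ n % q
  toℕ-[] n = Fin.toℕ-fromℕ< (m%n<n n q)

  []-cong : ∀ {m n} → m % q ≡ n % q → [ m ] ≡ [ n ]
  []-cong {m} {n} eq = Fin.toℕ-injective (trans (toℕ-[] m) (trans eq (sym (toℕ-[] n))))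

  []-injective : ∀ {m n} → [ m ] ≡ [ n ] → m % q ≡ n % q
  []-injective {m} {n} eq = trans (sym (toℕ-[] m)) (trans (cong toℕ eq) (toℕ-[] n))

  [toℕ] : ∀ a → [ toℕ a ] ≡ a
  [toℕ] a = Fin.toℕ-injective (trans (toℕ-[] (toℕ a)) (m<n⇒m%n≡m (Fin.toℕ<n a)))

  +-homo : ∀ m n → [ m ] +ᶠ [ n ] ≡ [ m ℕ.+ n ]
  +-homo m n = []-cong (trans (cong₂ (λ i j → (i ℕ.+ j) % q) (toℕ-[] m) (toℕ-[] n)) (sym (%-distribˡ-+ m n q)))

  *-homo : ∀ m n → [ m ] *ᶠ [ n ] ≡ [ m ℕ.* n ]
  *-homo m n = []-cong (trans (cong₂ (λ i j → (i ℕ.* j) % q) (toℕ-[] m) (toℕ-[] n)) (sym (%-distribˡ-* m n q)))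

  infix 8 -ᶠ_
  -ᶠ_ : F q → F q
  -ᶠ a = [ q ℕ.∸ toℕ a ]

  private
    +-[] : ∀ m a → [ m ] +ᶠ a ≡ [ m ℕ.+ toℕ a ]
    +-[] m a = trans (cong ([ m ] +ᶠ_) (sym ([toℕ] a))) (+-homo m (toℕ a))

    []-+ : ∀ a m → a +ᶠ [ m ] ≡ [ toℕ a ℕ.+ m ]
    []-+ a m = trans (cong (_+ᶠ [ m ]) (sym ([toℕ] a))) (+-homo (toℕ a) m)

    *-[] : ∀ m a → [ m ] *ᶠ a ≡ [ m ℕ.* toℕ a ]
    *-[] m a = trans (cong ([ m ] *ᶠ_) (sym ([toℕ] a))) (*-homo m (toℕ a))

    []-* : ∀ a m → a *ᶠ [ m ] ≡ [ toℕ a ℕ.* m ]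
    []-* a m = trans (cong (_*ᶠ [ m ]) (sym ([toℕ] a))) (*-homo (toℕ a) m)

    +-comm : ∀ a b → a +ᶠ b ≡ b +ᶠ a
    +-comm a b = cong [_] (ℕ.+-comm (toℕ a) (toℕ b))

    *-comm : ∀ a b → a *ᶠ b ≡ b *ᶠ a
    *-comm a b = cong [_] (ℕ.*-comm (toℕ a) (toℕ b))

    +-assoc : ∀ a b c → (a +ᶠ b) +ᶠ c ≡ a +ᶠ (b +ᶠ c)
    +-assoc a b c = trans (+-[] (toℕ a ℕ.+ toℕ b) c)
      (trans (cong [_] (ℕ.+-assoc (toℕ a) (toℕ b) (toℕ c))) (sym ([]-+ a (toℕ b ℕ.+ toℕ c))))

    *-assoc : ∀ a b c → (a *ᶠ b) *ᶠ c ≡ a *ᶠ (b *ᶠ c)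
    *-assoc a b c = trans (*-[] (toℕ a ℕ.* toℕ b) c)
      (trans (cong [_] (ℕ.*-assoc (toℕ a) (toℕ b) (toℕ c))) (sym ([]-* a (toℕ b ℕ.* toℕ c))))

    +-identityˡ : ∀ a → 0ᶠ +ᶠ a ≡ a
    +-identityˡ a = trans (+-[] 0 a) ([toℕ] a)

    *-identityˡ : ∀ a → 1ᶠ *ᶠ a ≡ a
    *-identityˡ a = trans (*-[] 1 a) (trans (cong [_] (ℕ.*-identityˡ (toℕ a))) ([toℕ] a))

    *-distribˡ-+ : ∀ a b c → a *ᶠ (b +ᶠ c) ≡ a *ᶠ b +ᶠ a *ᶠ c
    *-distribˡ-+ a b c = trans ([]-* a (toℕ b ℕ.+ toℕ c))
      (trans (cong [_] (ℕ.*-distribˡ-+ (toℕ a) (toℕ b) (toℕ c)))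
        (sym (+-homo (toℕ a ℕ.* toℕ b) (toℕ a ℕ.* toℕ c))))

    -‿inverseˡ : ∀ a → -ᶠ a +ᶠ a ≡ 0ᶠ
    -‿inverseˡ a = trans (+-[] (q ℕ.∸ toℕ a) a) ([]-cong (trans
      (cong (_% q) (ℕ.m∸n+n≡m (ℕ.<⇒≤ (Fin.toℕ<n a)))) (trans (n%n≡0 q) (sym (m*n%n≡0 0 q)))))

  commutativeRing : CommutativeRing _ _
  commutativeRing = record
    { Carrier = F q
    ; _≈_ = _≡_
    ; _+_ = _+ᶠ_
    ; _*_ = _*ᶠ_
    ; -_  = -ᶠ_
    ; 0#  = 0ᶠ
    ; 1#  = 1ᶠ
    ; isCommutativeRing = record
      { isRing = record
        { +-isAbelianGroup = record
          { isGroup = record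
            { isMonoid = record
              { isSemigroup = record { isMagma = isMagma _+ᶠ_ ; assoc = +-assoc }
              ; identity = +-identityˡ , λ a → trans (+-comm a 0ᶠ) (+-identityˡ a)
              }
            ; inverse = -‿inverseˡ , λ a → trans (+-comm a (-ᶠ a)) (-‿inverseˡ a)
            ; ⁻¹-cong = cong -ᶠ_
            }
          ; comm = +-comm
          }
        ; *-cong = cong₂ _*ᶠ_
        ; *-assoc = *-assoc
        ; *-identity = *-identityˡ , λ a → trans (*-comm a 1ᶠ) (*-identityˡ a)
        ; distrib = *-distribˡ-+ , λ a b c → trans (*-comm (b +ᶠ c) a)
            (trans (*-distribˡ-+ a b c) (cong₂ _+ᶠ_ (*-comm a b) (*-comm a c)))
        }
      ; *-comm = *-comm
      }
    }

  points-unique : Unique (points {q})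
  points-unique = cartesianProduct⁺ (allFin⁺ q) (allFin⁺ q)

  points-complete : ∀ x → x ∈ points {q}
  points-complete (a , b) = ∈-cartesianProduct⁺ (∈-allFin a) (∈-allFin b)

module PrimeField (q : ℕ) .{{q≢0 : NonZero q}} (prime : Prime q) where

  open ModularRing q public
  open CommutativeRing commutativeRing public using
    (*-identityˡ; *-identityʳ; *-assoc; *-comm; zeroˡ; zeroʳ; *-commutativeMonoid; *-monoid; isCommutativeRing)
    renaming (+-comm to +ᶠ-comm)
  open RingIdentities isCommutativeRing public hiding (commutativeRing)

  _≟ᶠ_ : DecidableEquality (F q)
  _≟ᶠ_ = Fin._≟_

  []≡0⇒∣ : ∀ {n} → [ n ] ≡ 0ᶠ → q ∣ n
  []≡0⇒∣ {n} eq = m%n≡0⇒n∣m n q (trans ([]-injective {n} {0} eq) (m*n%n≡0 0 q))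

  ∣⇒[]≡0 : ∀ {n} → q ∣ n → [ n ] ≡ 0ᶠ
  ∣⇒[]≡0 {n} q∣n = []-cong {n} {0} (trans (n∣m⇒m%n≡0 n q q∣n) (sym (m*n%n≡0 0 q)))

  no-zero-divisors : ∀ (a b : F q) → a *ᶠ b ≡ 0ᶠ → a ≡ 0ᶠ ⊎ b ≡ 0ᶠ
  no-zero-divisors a b ab≡0 with euclidsLemma (toℕ a) (toℕ b) prime ([]≡0⇒∣ ab≡0)
  ... | inj₁ q∣a = inj₁ (trans (sym ([toℕ] a)) (∣⇒[]≡0 q∣a))
  ... | inj₂ q∣b = inj₂ (trans (sym ([toℕ] b)) (∣⇒[]≡0 q∣b))

  -- Bézout for q and the representative of a. Over ℕ the identity comes in two sign patterns: one
  -- gives y · a = 1, the other y · a = -1, whence the negation.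
  inverse : ∀ (a : F q) → a ≢ 0ᶠ → ∃[ b ] b *ᶠ a ≡ 1ᶠ
  inverse a a≢0 = invert (toℕ a) ([toℕ] a) (Fin.toℕ<n a)
    where
    open ≡-Reasoning
    invert : ∀ n → [ n ] ≡ a → n ℕ.< q → ∃[ b ] b *ᶠ a ≡ 1ᶠ
    invert zero    0≡a _   = contradiction (sym 0≡a) a≢0
    invert (suc k) eq  k<q with coprime-Bézout (prime⇒coprime prime k<q)
    ... | Bézout.-+ x y 1+xq≡yn = [ y ] , (begin
      [ y ] *ᶠ a                  ≡⟨ cong ([ y ] *ᶠ_) (sym eq) ⟩
      [ y ] *ᶠ [ suc k ]          ≡⟨ *-homo y (suc k) ⟩
      [ y ℕ.* suc k ]             ≡⟨ cong [_] (sym 1+xq≡yn) ⟩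
      [ 1 ℕ.+ x ℕ.* q ]           ≡⟨ []-cong ([m+kn]%n≡m%n 1 x q) ⟩
      1ᶠ                          ∎)
    ... | Bézout.+- x y 1+yn≡xq = -ᶠ [ y ] , 1+ya≡0⇒[-y]a≡1 [ y ] a (begin
      1ᶠ +ᶠ [ y ] *ᶠ a            ≡⟨ cong (λ b → 1ᶠ +ᶠ [ y ] *ᶠ b) (sym eq) ⟩
      1ᶠ +ᶠ [ y ] *ᶠ [ suc k ]    ≡⟨ cong (1ᶠ +ᶠ_) (*-homo y (suc k)) ⟩
      1ᶠ +ᶠ [ y ℕ.* suc k ]       ≡⟨ +-homo 1 (y ℕ.* suc k) ⟩
      [ 1 ℕ.+ y ℕ.* suc k ]       ≡⟨ ∣⇒[]≡0 (divides x 1+yn≡xq) ⟩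
      0ᶠ                          ∎)

  1≢0 : 1ᶠ ≢ 0ᶠ
  1≢0 1≡0 = ℕ.<⇒≱ (ℕ.nonTrivial⇒n>1 q {{prime⇒nonTrivial prime}}) (∣⇒≤ ([]≡0⇒∣ {1} 1≡0))

  open Field _≟ᶠ_ no-zero-divisors inverse public

-- Fermat's little theorem and the non-squareness of -1

module Fermat (m : ℕ) (prime : Prime (suc m)) where

  open PrimeField (suc m) prime
  module Π = CommutativeMonoidSum *-commutativeMonoid
  open MonoidMult *-monoid public using () renaming (_×_ to _^[_])

  private
    q = suc m

    -- Replacing 0 by 1 lets the product of the nonzero elements be taken over all of `Fin q`, which
    -- scaling permutes.
    unit : F q → F q
    unit x with x ≟ᶠ 0ᶠ
    ... | yes _ = 1ᶠ
    ... | no  _ = x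

    unit≢0 : ∀ x → unit x ≢ 0ᶠ
    unit≢0 x with x ≟ᶠ 0ᶠ
    ... | yes _  = 1≢0
    ... | no x≢0 = x≢0

    Π≢0 : ∀ {n} (f : Fin n → F q) → (∀ i → f i ≢ 0ᶠ) → Π.sum f ≢ 0ᶠ
    Π≢0 {zero}  f f≢0 = 1≢0
    Π≢0 {suc n} f f≢0 = *-nonzero (f≢0 fzero) (Π≢0 (f ∘ fsuc) (f≢0 ∘ fsuc))

  -- Multiplication by a permutes the field and multiplies each of the m nonzero factors of the
  -- product by a; that product is nonzero and cancels. In the multiplicative monoid `Π.sum` is a
  -- product and `m ^[ a ]` is a power of a.
  fermat : ∀ a → a ≢ 0ᶠ → m ^[ a ] ≡ 1ᶠ
  fermat a a≢0 = *-cancelʳ-nonzero (Π≢0 unit unit≢0) (begin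
    m ^[ a ] *ᶠ Π.sum unit                          ≡⟨ cong (_*ᶠ Π.sum unit) (sym Π-factor) ⟩
    Π.sum factor *ᶠ Π.sum unit                      ≡⟨ Π.∑-distrib-+ factor unit ⟨
    Π.sum (λ x → factor x *ᶠ unit x)                ≡⟨ Π.sum-cong-≗ unit-scale ⟨
    Π.sum (λ x → unit (a *ᶠ x))                     ≡⟨ Π.sum-permute unit scaling ⟨
    Π.sum unit                                      ≡⟨ *-identityˡ (Π.sum unit) ⟨
    1ᶠ *ᶠ Π.sum unit                                ∎)
    where
    open ≡-Reasoning
    a⁻¹ = proj₁ (inverse a a≢0)
    a⁻¹a≡1 = proj₂ (inverse a a≢0)

    factor : F q → F q
    factor fzero    = 1ᶠ
    factor (fsuc _) = a

    Π-factor : Π.sum factor ≡ m ^[ a ]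
    Π-factor = trans (*-identityˡ _) (Π.sum-replicate m)

    unit-scale : ∀ x → unit (a *ᶠ x) ≡ factor x *ᶠ unit x
    unit-scale x with x ≟ᶠ 0ᶠ
    unit-scale .fzero | yes refl with (a *ᶠ 0ᶠ) ≟ᶠ 0ᶠ
    ... | yes _ = sym (*-identityˡ 1ᶠ)
    ... | no a0≢0 = contradiction (zeroʳ a) a0≢0
    unit-scale fzero | no 0≢0 = contradiction refl 0≢0
    unit-scale (fsuc i) | no x≢0 with (a *ᶠ fsuc i) ≟ᶠ 0ᶠ
    ... | yes ax≡0 = contradiction ax≡0 (*-nonzero a≢0 x≢0)
    ... | no _     = refl

    scaling : Permutation q q
    scaling = permutation (a *ᶠ_) (a⁻¹ *ᶠ_)
      (λ x → trans (sym (*-assoc a a⁻¹ x)) (trans (cong (_*ᶠ x) (trans (*-comm a a⁻¹) a⁻¹a≡1)) (*-identityˡ x)))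
      (λ x → trans (sym (*-assoc a⁻¹ a x)) (trans (cong (_*ᶠ x) a⁻¹a≡1) (*-identityˡ x)))

-- −1 is not a square: u² = −1 would give 1 = u^(q−1) = (−1)^((q−1)/2) = −1.
-1-nonsquare : ∀ q .{{_ : NonZero q}} (prime : Prime q) → q % 4 ≡ 3 →
  ∀ u → u *ᶠ u ≢ ModularRing.-ᶠ_ q 1ᶠ
-1-nonsquare (suc m) q-prime q%4≡3 u uu≡-1 = ℕ.<⇒≱ 2<q (∣⇒≤ ([]≡0⇒∣ {2} (trans (sym (+-homo 1 1)) 1+1≡0)))
  where
  open Fermat m q-prime
  open PrimeField (suc m) q-prime
  open MonoidMult *-monoid using (×-assocˡ)
  open ≡-Reasoning

  k = suc m / 4

  -- From q = 4k + 3, half of q - 1 is the odd number 2k + 1, so the corresponding power of -1 is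
  -- -1.
  m≡ : m ≡ suc (k ℕ.* 2) ℕ.* 2
  m≡ = ℕ.suc-injective (trans (m≡m%n+[m/n]*n (suc m) 4) (trans (cong (ℕ._+ k ℕ.* 4) q%4≡3) (regroup k)))
    where
    regroup : ∀ k → 3 ℕ.+ k ℕ.* 4 ≡ 1 ℕ.+ (1 ℕ.+ k ℕ.* 2) ℕ.* 2
    regroup = solve-∀

  2<q : 2 ℕ.< suc m
  2<q = ℕ.s≤s (subst (2 ℕ.≤_) (sym m≡) (ℕ.m≤m+n 2 (k ℕ.* 2 ℕ.* 2)))

  u≢0 : u ≢ 0ᶠ
  u≢0 refl = 1≢0 (-1≡0⇒1≡0 (trans (sym uu≡-1) (zeroˡ 0ᶠ)))

  one^ : ∀ n → n ^[ 1ᶠ ] ≡ 1ᶠ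
  one^ zero    = refl
  one^ (suc n) = trans (*-identityˡ _) (one^ n)

  1≡-1 : 1ᶠ ≡ -ᶠ 1ᶠ
  1≡-1 = begin
    1ᶠ                                          ≡⟨ fermat u u≢0 ⟨
    m ^[ u ]                                    ≡⟨ cong (_^[ u ]) m≡ ⟩
    (suc (k ℕ.* 2) ℕ.* 2) ^[ u ]                ≡⟨ ×-assocˡ u (suc (k ℕ.* 2)) 2 ⟨
    suc (k ℕ.* 2) ^[ 2 ^[ u ] ]                 ≡⟨ cong (suc (k ℕ.* 2) ^[_]) (trans (cong (u *ᶠ_) (*-identityʳ u)) uu≡-1) ⟩
    -ᶠ 1ᶠ *ᶠ ((k ℕ.* 2) ^[ -ᶠ 1ᶠ ])             ≡⟨ cong (-ᶠ 1ᶠ *ᶠ_) (×-assocˡ (-ᶠ 1ᶠ) k 2) ⟨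
    -ᶠ 1ᶠ *ᶠ (k ^[ 2 ^[ -ᶠ 1ᶠ ] ])              ≡⟨ cong (λ x → -ᶠ 1ᶠ *ᶠ (k ^[ x ])) [-1]²≡1 ⟩
    -ᶠ 1ᶠ *ᶠ (k ^[ 1ᶠ ])                        ≡⟨ cong (-ᶠ 1ᶠ *ᶠ_) (one^ k) ⟩
    -ᶠ 1ᶠ *ᶠ 1ᶠ                                 ≡⟨ *-identityʳ (-ᶠ 1ᶠ) ⟩
    -ᶠ 1ᶠ                                       ∎

  1+1≡0 : 1ᶠ +ᶠ 1ᶠ ≡ 0ᶠ
  1+1≡0 = a≡-a⇒a+a≡0 1≡-1

-- The size of the circle group

module Circle (q : ℕ) .{{_ : NonZero q}} (prime : Prime q) where

  open PrimeField q prime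

  circle : List (Point q)
  circle = filter (λ z → norm z ≟ᶠ 1ᶠ) points

  private
    square-roots : ∀ c → (∑[ b ∈ allFin q ] ⟦ (b *ᶠ b) ≟ᶠ c ⟧) ℕ.≤ 2
    square-roots c with Fin.any? (λ b → (b *ᶠ b) ≟ᶠ c)
    ... | no none = ℕ.≤-trans (ℕ.≤-reflexive (trans (∑-cong (λ b → ⟦⟧-false ((b *ᶠ b) ≟ᶠ c) (λ bb≡c → none (b , bb≡c))) (allFin q))
        (trans (∑-const (allFin q) 0) (ℕ.*-zeroʳ (length (allFin q)))))) ℕ.z≤n
    ... | yes (r , rr≡c) = begin
      (∑[ b ∈ allFin q ] ⟦ (b *ᶠ b) ≟ᶠ c ⟧)
        ≤⟨ ∑-mono (λ b → ⟦⟧-bound ((b *ᶠ b) ≟ᶠ c) (λ bb≡c → root b (equal-squares (trans bb≡c (sym rr≡c))))) (allFin q) ⟩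
      (∑[ b ∈ allFin q ] ⟦ b ≟ᶠ r ⟧ ℕ.* 1 ℕ.+ ⟦ b ≟ᶠ (-ᶠ r) ⟧ ℕ.* 1)
        ≡⟨ ∑-+ (allFin q) (λ b → ⟦ b ≟ᶠ r ⟧ ℕ.* 1) (λ b → ⟦ b ≟ᶠ (-ᶠ r) ⟧ ℕ.* 1) ⟩
      (∑[ b ∈ allFin q ] ⟦ b ≟ᶠ r ⟧ ℕ.* 1) ℕ.+ (∑[ b ∈ allFin q ] ⟦ b ≟ᶠ (-ᶠ r) ⟧ ℕ.* 1)
        ≡⟨ cong₂ ℕ._+_ (∑-δ r (λ _ → 1)) (∑-δ (-ᶠ r) (λ _ → 1)) ⟩
      2 ∎
      where
      open ℕ.≤-Reasoning
      open Listing _≟ᶠ_ (allFin q) (allFin⁺ q) ∈-allFin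
      root : ∀ b → b ≡ r ⊎ b ≡ -ᶠ r → 1 ℕ.≤ ⟦ b ≟ᶠ r ⟧ ℕ.* 1 ℕ.+ ⟦ b ≟ᶠ (-ᶠ r) ⟧ ℕ.* 1
      root b (inj₁ b≡r)  = subst (λ i → 1 ℕ.≤ i ℕ.* 1 ℕ.+ ⟦ b ≟ᶠ (-ᶠ r) ⟧ ℕ.* 1) (sym (⟦⟧-true (b ≟ᶠ r) b≡r)) (ℕ.m≤m+n 1 _)
      root b (inj₂ b≡-r) = subst (λ i → 1 ℕ.≤ ⟦ b ≟ᶠ r ⟧ ℕ.* 1 ℕ.+ i ℕ.* 1) (sym (⟦⟧-true (b ≟ᶠ (-ᶠ r)) b≡-r)) (ℕ.m≤n+m 1 _)

  length-allFin : length (allFin q) ≡ q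
  length-allFin = length-tabulate id

  -- For each of the q values of a, the equation b² = 1 - a² has at most two roots.
  circle-length : length circle ℕ.≤ q ℕ.* 2
  circle-length = begin
    length circle
      ≡⟨ trans (length≡∑1 circle) (∑-filter (λ z → norm z ≟ᶠ 1ᶠ) points (λ _ → 1)) ⟩
    (∑[ z ∈ points ] ⟦ norm z ≟ᶠ 1ᶠ ⟧ ℕ.* 1)
      ≡⟨ ∑-cartesianProduct (allFin q) (allFin q) _ ⟩
    (∑[ a ∈ allFin q ] ∑[ b ∈ allFin q ] ⟦ norm (a , b) ≟ᶠ 1ᶠ ⟧ ℕ.* 1)
      ≤⟨ ∑-mono (λ a → ∑-mono (λ b → ℕ.≤-trans (ℕ.≤-reflexive (ℕ.*-identityʳ _))
           (⟦⟧-mono (norm (a , b) ≟ᶠ 1ᶠ) ((b *ᶠ b) ≟ᶠ (1ᶠ - a *ᶠ a)) a+b≡c⇒b≡c-a)) (allFin q)) (allFin q) ⟩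
    (∑[ a ∈ allFin q ] ∑[ b ∈ allFin q ] ⟦ (b *ᶠ b) ≟ᶠ (1ᶠ - a *ᶠ a) ⟧)
      ≤⟨ ∑-mono (λ a → square-roots (1ᶠ - a *ᶠ a)) (allFin q) ⟩
    (∑[ a ∈ allFin q ] 2)
      ≡⟨ trans (∑-const (allFin q) 2) (cong (ℕ._* 2) length-allFin) ⟩
    q ℕ.* 2 ∎
    where open ℕ.≤-Reasoning

-- Congruence as an equivalence, and its rotations and reflections

module Congruence (q : ℕ) .{{_ : NonZero q}} (prime : Prime q) where

  open PrimeField q prime

  private
    module Columns (a b c d : F q) (orthogonal : Orthogonal ((a , b) , (c , d))) =
      Orthonormal {a} {b} {c} {d} (cong (proj₁ ∘ proj₁) orthogonal) (cong (proj₂ ∘ proj₁) orthogonal) (cong (proj₂ ∘ proj₂) orthogonal)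

    I-orthogonal : Orthogonal {q} I
    I-orthogonal = let (p , r , s , t) = identity-column in cong₂ _,_ (cong₂ _,_ p r) (cong₂ _,_ s t)

    ᵀ-orthogonal : ∀ (θ : Matrix q) → Orthogonal θ → Orthogonal (θ ᵀ)
    ᵀ-orthogonal ((a , b) , (c , d)) o = cong₂ _,_ (cong₂ _,_ aa+bb ac+bd)
      (cong₂ _,_ (trans (cong₂ _+ᶠ_ (*-comm c a) (*-comm d b)) ac+bd) cc+dd)
      where open Columns a b c d o

    -- The Gram matrix of the product consists of dot products of θ applied to the columns of η, and
    -- θ preserves dot products.
    ⊗-orthogonal : ∀ (θ η : Matrix q) → Orthogonal θ → Orthogonal η → Orthogonal (θ ⊗ η)
    ⊗-orthogonal ((a , b) , (c , d)) ((a′ , b′) , (c′ , d′)) o o′ = trans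
      (cong₂ _,_
        (cong₂ _,_ (dot-preserved a′ c′ a′ c′) (dot-preserved a′ c′ b′ d′))
        (cong₂ _,_ (dot-preserved b′ d′ a′ c′) (dot-preserved b′ d′ b′ d′))) o′
      where open Columns a b c d o

    ·-identity : ∀ (x : Point q) → x ≡ I · x ⊕ (0ᶠ , 0ᶠ)
    ·-identity (x₁ , x₂) = cong₂ _,_ (identity-coordinate₁ x₁ x₂) (identity-coordinate₂ x₁ x₂)

    opposite : Point q → Point q
    opposite (x₁ , x₂) = -ᶠ x₁ , -ᶠ x₂

    ·-invert : ∀ (θ : Matrix q) τ {x y} → Orthogonal θ → y ≡ θ · x ⊕ τ → x ≡ (θ ᵀ) · y ⊕ opposite ((θ ᵀ) · τ)
    ·-invert ((a , b) , (c , d)) (τ₁ , τ₂) {x₁ , x₂} o refl =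
      cong₂ _,_ (transpose-inverse₁ x₁ x₂ τ₁ τ₂) (transpose-inverse₂ x₁ x₂ τ₁ τ₂)
      where open Columns a b c d o

    ·-compose : ∀ (θ η : Matrix q) τ σ {x y z} → y ≡ η · x ⊕ σ → z ≡ θ · y ⊕ τ → z ≡ (θ ⊗ η) · x ⊕ (θ · σ ⊕ τ)
    ·-compose ((a , b) , (c , d)) ((a′ , b′) , (c′ , d′)) (τ₁ , τ₂) (σ₁ , σ₂) {x₁ , x₂} refl refl = cong₂ _,_
      (compose-coordinate a b a′ b′ c′ d′ x₁ x₂ σ₁ σ₂ τ₁) (compose-coordinate c d a′ b′ c′ d′ x₁ x₂ σ₁ σ₂ τ₂)

  ≅-isEquivalence : IsEquivalence (_≅_ {q})
  ≅-isEquivalence = record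
    { refl  = I , I-orthogonal , (0ᶠ , 0ᶠ) , ·-identity _ , ·-identity _ , ·-identity _
    ; sym   = λ (θ , o , τ , e₁ , e₂ , e₃) → θ ᵀ , ᵀ-orthogonal θ o , opposite ((θ ᵀ) · τ) ,
        ·-invert θ τ o e₁ , ·-invert θ τ o e₂ , ·-invert θ τ o e₃
    ; trans = λ (η , o , σ , e₁ , e₂ , e₃) (θ , o′ , τ , f₁ , f₂ , f₃) → θ ⊗ η , ⊗-orthogonal θ η o′ o , θ · σ ⊕ τ ,
        ·-compose θ η τ σ e₁ f₁ , ·-compose θ η τ σ e₂ f₂ , ·-compose θ η τ σ e₃ f₃
    }

  -- `h` is the identity for rotations and conjugation for reflections. The translation stands first
  -- to agree with the form of `at z (h x) τ`.
  Rigid : (Point q → Point q) → Point q → Point q → Triple q → Triple q → Set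
  Rigid h z τ (x¹ , x² , x³) (y¹ , y² , y³) =
    y¹ ≡ τ ⊞ rotate z (h x¹) × y² ≡ τ ⊞ rotate z (h x²) × y³ ≡ τ ⊞ rotate z (h x³)

  ⊕-comm : ∀ (x y : Point q) → x ⊕ y ≡ y ⊞ x
  ⊕-comm (x₁ , x₂) (y₁ , y₂) = cong₂ _,_ (+ᶠ-comm x₁ y₁) (+ᶠ-comm x₂ y₂)

  ≅⇒rigid : ∀ (s t : Triple q) → s ≅ t →
    ∃[ z ] (norm z ≡ 1ᶠ × ∃[ τ ] (Rigid id z τ s t ⊎ Rigid conj z τ s t))
  ≅⇒rigid s t (((a , b) , (c , d)) , o , τ , e₁ , e₂ , e₃) =
    (a , c) , cong (proj₁ ∘ proj₁) o , τ , [ (λ det≡1 → inj₁ (turn id (λ (x₁ , x₂) → rotation det≡1 x₁ x₂)))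
      , (λ det≡-1 → inj₂ (turn conj (λ (x₁ , x₂) → reflection det≡-1 x₁ x₂))) ]′ (det≡±1 det²)
    where
    open Columns a b c d o
    turn : ∀ h → (∀ x → ((a , b) , (c , d)) · x ≡ rotate (a , c) (h x)) → Rigid h (a , c) τ s t
    turn h eq = step e₁ , step e₂ , step e₃
      where
      step : ∀ {x y} → y ≡ ((a , b) , (c , d)) · x ⊕ τ → y ≡ τ ⊞ rotate (a , c) (h x)
      step {x} refl = trans (⊕-comm (((a , b) , (c , d)) · x) τ) (cong (τ ⊞_) (eq x))

-- Counting congruent pairs of triangles by incidences

module Counting (q : ℕ) .{{_ : NonZero q}} (prime : Prime q) (q%4≡3 : q % 4 ≡ 3)
  {E : Pred (Point q) 0ℓ} (E? : Decidable E) where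

  open PrimeField q prime
  open Anisotropic (-1-nonsquare q prime q%4≡3)
  open Circle q prime
  open Congruence q prime

  _≟ᵖ_ : DecidableEquality (Point q)
  _≟ᵖ_ = ≡-dec _≟ᶠ_ _≟ᶠ_

  open Listing _≟ᵖ_ points points-unique points-complete

  e : Point q → ℕ
  e x = ⟦ E? x ⟧

  ∑-elements : ∀ h → ∑ (elements E?) h ≡ (∑[ x ∈ points ] e x ℕ.* h x)
  ∑-elements = ∑-filter E? points

  -- The weight is the indicator of h(E) × E. Taking `h` to be conjugation treats reflections of E
  -- as rotations of its mirror image, so one net serves both cases.
  module Incidences (h : Point q ↔ Point q) = Net _≟ᵖ_ points points-unique points-complete label
    (λ x y → e (Inverse.from h x) ℕ.* e y)

  open Inverse using (to; from)

  card≡∑ : card E? ≡ ∑ points e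
  card≡∑ = trans (length≡∑1 (elements E?)) (trans (∑-elements (λ _ → 1)) (∑-cong (λ x → ℕ.*-identityʳ (e x)) points))

  module _ (h : Point q ↔ Point q) where

    open Incidences h

    match : Point q → Point q → Point q → Point q → ℕ
    match z τ x y = ⟦ y ≟ᵖ (τ ⊞ rotate z (to h x)) ⟧

    match-true : ∀ {z τ x y} → y ≡ τ ⊞ rotate z (to h x) → 1 ≡ match z τ x y
    match-true {z} {τ} {x} {y} eq = sym (⟦⟧-true (y ≟ᵖ (τ ⊞ rotate z (to h x))) eq)

    matches : Point q → Point q → ℕ
    matches z τ = ∑[ x ∈ elements E? ] ∑[ y ∈ elements E? ] match z τ x y

    -- Given x, the only candidate for y is τ + z h(x), so the inner sum collapses; the outer one is
    -- then reindexed by `h`.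
    matches≡ν : ∀ z τ → matches z τ ≡ ν z τ
    matches≡ν z τ = begin
      matches z τ
        ≡⟨ ∑-elements _ ⟩
      (∑[ x ∈ points ] e x ℕ.* (∑[ y ∈ elements E? ] match z τ x y))
        ≡⟨ ∑-cong (λ x → cong (e x ℕ.*_) (trans (∑-elements _)
             (trans (∑-cong (λ y → ℕ.*-comm (e y) _) points) (∑-δ (τ ⊞ rotate z (to h x)) e)))) points ⟩
      (∑[ x ∈ points ] e x ℕ.* e (at z (to h x) τ))
        ≡⟨ ∑-cong (λ x → cong (λ x′ → e x′ ℕ.* e (at z (to h x) τ)) (sym (Inverse.strictlyInverseʳ h x))) points ⟩
      (∑[ x ∈ points ] e (from h (to h x)) ℕ.* e (at z (to h x) τ))
        ≡⟨ ∑-reindex h (λ x → e (from h x) ℕ.* e (at z x τ)) ⟩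
      ν z τ ∎
      where open ≡-Reasoning

    incidences : m ≡ card E? ℕ.* card E?
    incidences = trans (∑-product points points (λ x → e (from h x)) e)
      (trans (cong (ℕ._* ∑ points e) (∑-reindex⁻¹ h e)) (sym (cong₂ ℕ._*_ card≡∑ card≡∑)))

    ν≤card : ∀ z τ → ν z τ ℕ.≤ card E?
    ν≤card z τ = begin
      ν z τ                               ≤⟨ ∑-mono (λ x → ℕ.*-monoʳ-≤ (e (from h x)) (⟦⟧≤1 (E? (at z x τ)))) points ⟩
      (∑[ x ∈ points ] e (from h x) ℕ.* 1)  ≡⟨ ∑-cong (λ x → ℕ.*-identityʳ _) points ⟩
      (∑[ x ∈ points ] e (from h x))      ≡⟨ ∑-reindex⁻¹ h e ⟩
      ∑ points e                          ≡⟨ card≡∑ ⟨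
      card E?                             ∎
      where open ℕ.≤-Reasoning

    idempotent : ∀ x y → (e (from h x) ℕ.* e y) ℕ.* (e (from h x) ℕ.* e y) ≡ e (from h x) ℕ.* e y
    idempotent x y = trans (interchange (e (from h x)) (e y)) (cong₂ ℕ._*_ (⟦⟧-idem (E? (from h x))) (⟦⟧-idem (E? y)))
      where
      interchange : ∀ a b → (a ℕ.* b) ℕ.* (a ℕ.* b) ≡ (a ℕ.* a) ℕ.* (b ℕ.* b)
      interchange = solve-∀

    circle-transversal : AllPairs Transversal circle
    circle-transversal = AllPairs.map label-transversal (filter⁺ (λ z → norm z ≟ᶠ 1ᶠ) points-unique)

    cubes-circle : n ℕ.* n ℕ.* cubes circle
      ℕ.≤ card E? ℕ.* n ℕ.* n ℕ.* n ℕ.* m ℕ.+ 2 ℕ.* n ℕ.* n ℕ.* m ℕ.* m ℕ.+ length circle ℕ.* m ℕ.* m ℕ.* m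
    cubes-circle = cubes-bound idempotent {{n≢0}} ν≤card circle-transversal
      where
      n≢0 : NonZero n
      n≢0 = ℕ.>-nonZero (ℕ.<-≤-trans ℕ.z<s (∈⇒1≤n (points-complete (0ᶠ , 0ᶠ))))
        where
        ∈⇒1≤n : ∀ {x} → x ∈ points → 1 ℕ.≤ n
        ∈⇒1≤n x∈ = ℕ.≤-trans (∈⇒≤∑ (λ _ → 1) x∈) (ℕ.≤-reflexive (sym (length≡∑1 points)))

    triple-matches : Point q → Point q → Triple q → Triple q → ℕ
    triple-matches z τ (x¹ , x² , x³) (y¹ , y² , y³) = match z τ x¹ y¹ ℕ.* (match z τ x² y² ℕ.* match z τ x³ y³)

    -- For a fixed motion the conditions on the three vertices are independent, so the sum over
    -- pairs of triangles is the cube of the sum over pairs of points.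
    ∑-triple-matches : (∑[ z ∈ circle ] ∑[ τ ∈ points ] ∑[ s ∈ triangles E? ] ∑[ t ∈ triangles E? ] triple-matches z τ s t)
      ≡ cubes circle
    ∑-triple-matches = ∑-cong (λ z → ∑-cong (λ τ → begin
      (∑[ s ∈ triangles E? ] ∑[ t ∈ triangles E? ] triple-matches z τ s t)
        ≡⟨ ∑-pairs els (cartesianProduct els els) (match z τ) (pair-matches z τ) ⟩
      matches z τ ℕ.* (∑[ s ∈ cartesianProduct els els ] ∑[ t ∈ cartesianProduct els els ] pair-matches z τ s t)
        ≡⟨ cong (matches z τ ℕ.*_) (∑-pairs els els (match z τ) (match z τ)) ⟩
      matches z τ ℕ.* (matches z τ ℕ.* matches z τ)
        ≡⟨ cong (λ k → k ℕ.* (k ℕ.* k)) (matches≡ν z τ) ⟩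
      ν z τ ℕ.* (ν z τ ℕ.* ν z τ)
        ≡⟨ ℕ.*-assoc (ν z τ) (ν z τ) (ν z τ) ⟨
      ν z τ ℕ.* ν z τ ℕ.* ν z τ ∎) points) circle
      where
      open ≡-Reasoning
      els = elements E?
      pair-matches : Point q → Point q → Point q × Point q → Point q × Point q → ℕ
      pair-matches z τ s t = match z τ (proj₁ s) (proj₁ t) ℕ.* match z τ (proj₂ s) (proj₂ t)
      ∑-pairs : ∀ {A B : Set} (xs : List A) (ys : List B) (f : A → A → ℕ) (g : B → B → ℕ) →
        (∑[ s ∈ cartesianProduct xs ys ] ∑[ t ∈ cartesianProduct xs ys ] f (proj₁ s) (proj₁ t) ℕ.* g (proj₂ s) (proj₂ t))
          ≡ (∑[ x ∈ xs ] ∑[ x′ ∈ xs ] f x x′) ℕ.* (∑[ y ∈ ys ] ∑[ y′ ∈ ys ] g y y′)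
      ∑-pairs xs ys f g = trans (∑-cartesianProduct xs ys _)
        (trans (∑-cong (λ x → ∑-cong (λ y → trans (∑-cartesianProduct xs ys _) (∑-product xs ys (f x) (g y))) ys) xs)
          (∑-product xs ys (λ x → ∑ xs (f x)) (λ y → ∑ ys (g y))))

    rigid⇒1≤ : ∀ z τ (s t : Triple q) → norm z ≡ 1ᶠ → Rigid (to h) z τ s t →
      1 ℕ.≤ (∑[ z ∈ circle ] ∑[ τ ∈ points ] triple-matches z τ s t)
    rigid⇒1≤ z τ s t z∈circle (e₁ , e₂ , e₃) = begin
      1
        ≡⟨ cong₂ ℕ._*_ (match-true {z} {τ} e₁) (cong₂ ℕ._*_ (match-true {z} {τ} e₂) (match-true {z} {τ} e₃)) ⟩
      triple-matches z τ s t
        ≤⟨ ∈⇒≤∑ (λ τ → triple-matches z τ s t) (points-complete τ) ⟩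
      (∑[ τ ∈ points ] triple-matches z τ s t)
        ≤⟨ ∈⇒≤∑ (λ z → ∑[ τ ∈ points ] triple-matches z τ s t) (∈-filter⁺ (λ z → norm z ≟ᶠ 1ᶠ) (points-complete z) z∈circle) ⟩
      (∑[ z ∈ circle ] ∑[ τ ∈ points ] triple-matches z τ s t) ∎
      where open ℕ.≤-Reasoning

  id↔ : Point q ↔ Point q
  id↔ = ↔-id _

  -- Every congruent pair is realised by at least one rotation or reflection with a translation.
  -- Degenerate triangles may be realised by several, which only enlarges the right side.
  congruent-pairs : (∑[ s ∈ triangles E? ] ∑[ t ∈ triangles E? ] ⟦ s ≅? t ⟧)
    ℕ.≤ Incidences.cubes id↔ circle ℕ.+ Incidences.cubes conj↔ circle
  congruent-pairs = begin
    (∑[ s ∈ T ] ∑[ t ∈ T ] ⟦ s ≅? t ⟧)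
      ≤⟨ ∑-mono (λ s → ∑-mono (λ t → ⟦⟧-bound (s ≅? t) (one s t)) T) T ⟩
    (∑[ s ∈ T ] ∑[ t ∈ T ] total id↔ s t ℕ.+ total conj↔ s t)
      ≡⟨ trans (∑-cong (λ s → ∑-+ T (total id↔ s) (total conj↔ s)) T)
           (∑-+ T (λ s → ∑ T (total id↔ s)) (λ s → ∑ T (total conj↔ s))) ⟩
    (∑[ s ∈ T ] ∑[ t ∈ T ] total id↔ s t) ℕ.+ (∑[ s ∈ T ] ∑[ t ∈ T ] total conj↔ s t)
      ≡⟨ cong₂ ℕ._+_ (rearrange id↔) (rearrange conj↔) ⟩
    Incidences.cubes id↔ circle ℕ.+ Incidences.cubes conj↔ circle ∎
    where
    open ℕ.≤-Reasoning
    T = triangles E?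
    total : Point q ↔ Point q → Triple q → Triple q → ℕ
    total h s t = ∑[ z ∈ circle ] ∑[ τ ∈ points ] triple-matches h z τ s t

    one : ∀ s t → s ≅ t → 1 ℕ.≤ total id↔ s t ℕ.+ total conj↔ s t
    one s t s≅t = let (z , z∈circle , τ , rigid) = ≅⇒rigid s t s≅t in
      [ (λ r → ℕ.≤-trans (rigid⇒1≤ id↔ z τ s t z∈circle r) (ℕ.m≤m+n (total id↔ s t) (total conj↔ s t)))
      , (λ r → ℕ.≤-trans (rigid⇒1≤ conj↔ z τ s t z∈circle r) (ℕ.m≤n+m (total conj↔ s t) (total id↔ s t))) ]′ rigid

    rearrange : ∀ h → (∑[ s ∈ T ] ∑[ t ∈ T ] total h s t) ≡ Incidences.cubes h circle
    rearrange h = trans (∑-cong (λ s → pull T (λ t z τ → triple-matches h z τ s t)) T)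
      (trans (pull T (λ s z τ → ∑[ t ∈ T ] triple-matches h z τ s t)) (∑-triple-matches h))
      where
      pull : ∀ {A : Set} (xs : List A) (g : A → Point q → Point q → ℕ) →
        (∑[ x ∈ xs ] ∑[ z ∈ circle ] ∑[ τ ∈ points ] g x z τ) ≡ (∑[ z ∈ circle ] ∑[ τ ∈ points ] ∑[ x ∈ xs ] g x z τ)
      pull xs g = trans (∑-swap xs circle (λ x z → ∑ points (g x z))) (∑-cong (λ z → ∑-swap xs points (λ x τ → g x z τ)) circle)

-- The numerical estimate

^-cancelʳ-≤ : ∀ {a b} k .{{_ : NonZero k}} → a ^ k ℕ.≤ b ^ k → a ℕ.≤ b
^-cancelʳ-≤ {a} {b} k aᵏ≤bᵏ with a ℕ.≤? b
... | yes a≤b = a≤b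
... | no  a≰b = contradiction aᵏ≤bᵏ (ℕ.<⇒≱ (ℕ.^-monoˡ-< k (ℕ.≰⇒> a≰b)))

-- After division by q the three terms are q⁵ s³, 2 q³ s⁴ and at most 2 s⁶; the two power
-- inequalities turn them into 1, 2 and 2 copies of s⁶, hence the constant 5.
cubes-estimate : ∀ q s k r .{{_ : NonZero q}} → k ℕ.≤ q ℕ.* 2 → q ^ 5 ℕ.≤ s ^ 3 → q ^ 3 ℕ.≤ s ^ 2 →
  let n = q ℕ.* q; m = s ℕ.* s in
  n ℕ.* n ℕ.* r ℕ.≤ s ℕ.* n ℕ.* n ℕ.* n ℕ.* m ℕ.+ 2 ℕ.* n ℕ.* n ℕ.* m ℕ.* m ℕ.+ k ℕ.* m ℕ.* m ℕ.* m →
  q ^ 3 ℕ.* r ℕ.≤ 5 ℕ.* s ^ 6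
cubes-estimate q s k r k≤2q q⁵≤s³ q³≤s² bound = ℕ.*-cancelˡ-≤ q (begin
  q * (q ^ 3 * r)
    ≡⟨ left q r ⟩
  n * n * r
    ≤⟨ bound ⟩
  s * n * n * n * m + 2 * n * n * m * m + k * m * m * m
    ≤⟨ ℕ.+-monoʳ-≤ (s * n * n * n * m + 2 * n * n * m * m) (ℕ.*-monoˡ-≤ m (ℕ.*-monoˡ-≤ m (ℕ.*-monoˡ-≤ m k≤2q))) ⟩
  s * n * n * n * m + 2 * n * n * m * m + q * 2 * m * m * m
    ≡⟨ factor q s ⟩
  q * (q ^ 5 * s ^ 3 + (2 * (q ^ 3 * s ^ 4) + 2 * s ^ 6))
    ≤⟨ ℕ.*-monoʳ-≤ q (ℕ.+-mono-≤ (ℕ.*-monoˡ-≤ (s ^ 3) q⁵≤s³)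
         (ℕ.+-monoˡ-≤ (2 * s ^ 6) (ℕ.*-monoʳ-≤ 2 (ℕ.*-monoˡ-≤ (s ^ 4) q³≤s²)))) ⟩
  q * (s ^ 3 * s ^ 3 + (2 * (s ^ 2 * s ^ 4) + 2 * s ^ 6))
    ≡⟨ right q s ⟩
  q * (5 * s ^ 6) ∎)
  where
  open import Data.Nat.Base using (_*_; _+_)
  open +-*-Solver using (solve; con; _:=_; _:+_; _:*_; _:^_)
  open ℕ.≤-Reasoning
  n = q * q
  m = s * s
  left : ∀ q r → q * (q ^ 3 * r) ≡ q * q * (q * q) * r
  left = solve 2 (λ q r → q :* (q :^ 3 :* r) := q :* q :* (q :* q) :* r) refl
  factor : ∀ q s → s * (q * q) * (q * q) * (q * q) * (s * s) + 2 * (q * q) * (q * q) * (s * s) * (s * s) + q * 2 * (s * s) * (s * s) * (s * s)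
    ≡ q * (q ^ 5 * s ^ 3 + (2 * (q ^ 3 * s ^ 4) + 2 * s ^ 6))
  factor = solve 2 (λ q s → s :* (q :* q) :* (q :* q) :* (q :* q) :* (s :* s)
      :+ con 2 :* (q :* q) :* (q :* q) :* (s :* s) :* (s :* s) :+ q :* con 2 :* (s :* s) :* (s :* s) :* (s :* s)
    := q :* (q :^ 5 :* s :^ 3 :+ (con 2 :* (q :^ 3 :* s :^ 4) :+ con 2 :* s :^ 6))) refl
  right : ∀ q s → q * (s ^ 3 * s ^ 3 + (2 * (s ^ 2 * s ^ 4) + 2 * s ^ 6)) ≡ q * (5 * s ^ 6)
  right = solve 2 (λ q s → q :* (s :^ 3 :* s :^ 3 :+ (con 2 :* (s :^ 2 :* s :^ 4) :+ con 2 :* s :^ 6))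
    := q :* (con 5 :* s :^ 6)) refl

module _ (q : ℕ) .{{_ : NonZero q}} (prime : Prime q) (q%4≡3 : q % 4 ≡ 3)
  {E : Pred (Point q) 0ℓ} (E? : Decidable E) (q⁷≤e⁴ : q ^ 7 ℕ.≤ card E? ^ 4) where

  open Counting q prime q%4≡3 E? using (module Incidences; cubes-circle; incidences; id↔; congruent-pairs)
  open PrimeField q prime using (conj↔)
  open Circle q prime using (circle; circle-length; length-allFin)
  open Congruence q prime using (≅-isEquivalence)
  open ℕ.≤-Reasoning

  private
    s t : ℕ
    s = card E?
    t = card-T₂ E?

    instance
      -- E is nonempty since q⁷ is positive; this permits the final cancellation of s⁶.
      s≢0 : NonZero s
      s≢0 = ℕ.>-nonZero (ℕ.n≢0⇒n>0 (λ s≡0 → ℕ.≢-nonZero⁻¹ (q ^ 7) {{ℕ.m^n≢0 q 7}}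
        (ℕ.n≤0⇒n≡0 (subst (λ s → q ^ 7 ℕ.≤ s ^ 4) s≡0 q⁷≤e⁴))))

    length-points : length (points {q}) ≡ q ℕ.* q
    length-points = trans (length-cartesianProduct (allFin q) (allFin q))
      (cong₂ ℕ._*_ length-allFin length-allFin)

    q⁵≤s³ : q ^ 5 ℕ.≤ s ^ 3
    q⁵≤s³ = ^-cancelʳ-≤ 4 (begin
      (q ^ 5) ^ 4   ≡⟨ ℕ.^-*-assoc q 5 4 ⟩
      q ^ 20        ≤⟨ ℕ.^-monoʳ-≤ q (ℕ.m≤n+m 20 1) ⟩
      q ^ 21        ≡⟨ ℕ.^-*-assoc q 7 3 ⟨
      (q ^ 7) ^ 3   ≤⟨ ℕ.^-monoˡ-≤ 3 q⁷≤e⁴ ⟩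
      (s ^ 4) ^ 3   ≡⟨ trans (ℕ.^-*-assoc s 4 3) (sym (ℕ.^-*-assoc s 3 4)) ⟩
      (s ^ 3) ^ 4   ∎)

    q³≤s² : q ^ 3 ℕ.≤ s ^ 2
    q³≤s² = ^-cancelʳ-≤ 2 (begin
      (q ^ 3) ^ 2   ≡⟨ ℕ.^-*-assoc q 3 2 ⟩
      q ^ 6         ≤⟨ ℕ.^-monoʳ-≤ q (ℕ.m≤n+m 6 1) ⟩
      q ^ 7         ≤⟨ q⁷≤e⁴ ⟩
      s ^ 4         ≡⟨ ℕ.^-*-assoc s 2 2 ⟨
      (s ^ 2) ^ 2   ∎)

    cubes≤ : ∀ h → q ^ 3 ℕ.* Incidences.cubes h circle ℕ.≤ 5 ℕ.* s ^ 6
    cubes≤ h = cubes-estimate q s (length circle) (Incidences.cubes h circle) circle-length q⁵≤s³ q³≤s²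
      (subst₂ (λ n m → n ℕ.* n ℕ.* Incidences.cubes h circle ℕ.≤
          s ℕ.* n ℕ.* n ℕ.* n ℕ.* m ℕ.+ 2 ℕ.* n ℕ.* n ℕ.* m ℕ.* m ℕ.+ length circle ℕ.* m ℕ.* m ℕ.* m)
        length-points (incidences h) (cubes-circle h))

    length-triangles : length (triangles E?) ≡ s ^ 3
    length-triangles = trans (length-cartesianProduct (elements E?) (cartesianProduct (elements E?) (elements E?)))
      (cong (s ℕ.*_) (trans (length-cartesianProduct (elements E?) (elements E?))
        (cong (s ℕ.*_) (sym (ℕ.*-identityʳ s)))))

    pairs : ℕ
    pairs = ∑[ x ∈ triangles E? ] ∑[ y ∈ triangles E? ] ⟦ x ≅? y ⟧

  -- Ten is five from the rotations plus five from the reflections.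
  q³≤10*card-T₂ : q ^ 3 ℕ.≤ 10 ℕ.* card-T₂ E?
  q³≤10*card-T₂ = ℕ.*-cancelʳ-≤ (q ^ 3) (10 ℕ.* t) (s ^ 6) {{ℕ.m^n≢0 s 6}} (begin
    q ^ 3 ℕ.* s ^ 6
      ≡⟨ cong (q ^ 3 ℕ.*_) (ℕ.^-distribˡ-+-* s 3 3) ⟩
    q ^ 3 ℕ.* (s ^ 3 ℕ.* s ^ 3)
      ≤⟨ ℕ.*-monoʳ-≤ (q ^ 3) (subst (λ l → l ℕ.* l ℕ.≤ t ℕ.* pairs) length-triangles
           (Classes.length²≤classes*pairs _≅?_ ≅-isEquivalence (triangles E?))) ⟩
    q ^ 3 ℕ.* (t ℕ.* pairs)
      ≤⟨ ℕ.*-monoʳ-≤ (q ^ 3) (ℕ.*-monoʳ-≤ t congruent-pairs) ⟩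
    q ^ 3 ℕ.* (t ℕ.* (Incidences.cubes id↔ circle ℕ.+ Incidences.cubes conj↔ circle))
      ≡⟨ expand (q ^ 3) t (Incidences.cubes id↔ circle) (Incidences.cubes conj↔ circle) ⟩
    t ℕ.* (q ^ 3 ℕ.* Incidences.cubes id↔ circle ℕ.+ q ^ 3 ℕ.* Incidences.cubes conj↔ circle)
      ≤⟨ ℕ.*-monoʳ-≤ t (ℕ.+-mono-≤ (cubes≤ id↔) (cubes≤ conj↔)) ⟩
    t ℕ.* (5 ℕ.* s ^ 6 ℕ.+ 5 ℕ.* s ^ 6)
      ≡⟨ collect t (s ^ 6) ⟩
    10 ℕ.* t ℕ.* s ^ 6 ∎)
    where
    expand : ∀ a t x y → a ℕ.* (t ℕ.* (x ℕ.+ y)) ≡ t ℕ.* (a ℕ.* x ℕ.+ a ℕ.* y)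
    expand = solve-∀
    collect : ∀ t z → t ℕ.* (5 ℕ.* z ℕ.+ 5 ℕ.* z) ≡ 10 ℕ.* t ℕ.* z
    collect = solve-∀

-- Passage between the real-number bounds and natural numbers

toℚᵘ-fromℕ : ∀ n → ℚ.toℚᵘ (fromℕ n) ℚᵘ.≃ ℚᵘ.mkℚᵘ (ℤ.+ n) 0
toℚᵘ-fromℕ n = ℚ.toℚᵘ-fromℚᵘ (ℚᵘ.mkℚᵘ (ℤ.+ n) 0)

fromℕ-* : ∀ m n → fromℕ (m ℕ.* n) ≡ fromℕ m ℚ.* fromℕ n
fromℕ-* m n = ℚ.toℚᵘ-injective (begin-equality
  ℚ.toℚᵘ (fromℕ (m ℕ.* n))                          ≃⟨ toℚᵘ-fromℕ (m ℕ.* n) ⟩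
  ℚᵘ.mkℚᵘ (ℤ.+ (m ℕ.* n)) 0                         ≡⟨ cong (λ i → ℚᵘ.mkℚᵘ i 0) (ℤ.pos-* m n) ⟩
  ℚᵘ.mkℚᵘ (ℤ.+ m) 0 ℚᵘ.* ℚᵘ.mkℚᵘ (ℤ.+ n) 0          ≃⟨ ℚᵘ.*-cong (toℚᵘ-fromℕ m) (toℚᵘ-fromℕ n) ⟨
  ℚ.toℚᵘ (fromℕ m) ℚᵘ.* ℚ.toℚᵘ (fromℕ n)            ≃⟨ ℚ.toℚᵘ-homo-* (fromℕ m) (fromℕ n) ⟨
  ℚ.toℚᵘ (fromℕ m ℚ.* fromℕ n)                      ∎)
  where open ℚᵘ.≤-Reasoning

fromℕ-mono-≤ : ∀ {m n} → m ℕ.≤ n → fromℕ m ℚ.≤ fromℕ n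
fromℕ-mono-≤ {m} {n} m≤n = ℚ.toℚᵘ-cancel-≤ (begin
  ℚ.toℚᵘ (fromℕ m)       ≃⟨ toℚᵘ-fromℕ m ⟩
  ℚᵘ.mkℚᵘ (ℤ.+ m) 0      ≤⟨ ℚᵘ.*≤* (ℤ.*-monoʳ-≤-nonNeg (ℤ.+ 1) (ℤ.+≤+ m≤n)) ⟩
  ℚᵘ.mkℚᵘ (ℤ.+ n) 0      ≃⟨ toℚᵘ-fromℕ n ⟨
  ℚ.toℚᵘ (fromℕ n)       ∎)
  where open ℚᵘ.≤-Reasoning

fromℕ-cancel-≤ : ∀ {m n} → fromℕ m ℚ.≤ fromℕ n → m ℕ.≤ n
fromℕ-cancel-≤ {m} {n} fm≤fn = ℤ.drop‿+≤+ (ℤ.*-cancelʳ-≤-pos (ℤ.+ m) (ℤ.+ n) (ℤ.+ 1) (ℚᵘ.drop-*≤* (begin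
  ℚᵘ.mkℚᵘ (ℤ.+ m) 0      ≃⟨ toℚᵘ-fromℕ m ⟨
  ℚ.toℚᵘ (fromℕ m)       ≤⟨ ℚ.toℚᵘ-mono-≤ fm≤fn ⟩
  ℚ.toℚᵘ (fromℕ n)       ≃⟨ toℚᵘ-fromℕ n ⟩
  ℚᵘ.mkℚᵘ (ℤ.+ n) 0      ∎)))
  where open ℚᵘ.≤-Reasoning

fromℕ-⁴ : ∀ n → fromℕ n ⁴ ≡ fromℕ (n ^ 4)
fromℕ-⁴ n = sym (trans (cong fromℕ (regroup n))
  (trans (fromℕ-* (n ℕ.* n) (n ℕ.* n)) (cong₂ ℚ._*_ (fromℕ-* n n) (fromℕ-* n n))))
  where
  regroup : ∀ n → n ^ 4 ≡ n ℕ.* n ℕ.* (n ℕ.* n)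
  open +-*-Solver using (solve; _:=_; _:*_; _:^_)
  regroup = solve 1 (λ n → n :^ 4 := n :* n :* (n :* n)) refl

2≤r⁴⇒1≤r : ∀ {r} → 0ℚ ℚ.≤ r → fromℕ 2 ℚ.≤ r ⁴ → 1ℚ ℚ.≤ r
2≤r⁴⇒1≤r {r} 0≤r 2≤r⁴ with 1ℚ ℚ.≤? r
... | yes 1≤r = 1≤r
... | no  1≰r = contradiction (ℚ.≤-<-trans 2≤r⁴ (⁴-mono-< 0≤r (ℚ.≰⇒> 1≰r))) (λ { (ℚ.*<* (ℤ.+<+ (ℕ.s≤s ()))) })

-- Any rational above C₁ exceeds some r with r⁴ ≥ 2, so it is at least 1. The upper endpoint product
-- b d in the cut for the right-hand side then exceeds a rational u with u⁴ ≥ q⁷, and `s` lies above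
-- that product.
card-power-bound : ∀ {C₁ q s} → C₁ >ʳ ∜ 2 → natʳ s >ʳ C₁ *ʳ ∜ (q ^ 7) → q ^ 7 ℕ.≤ s ^ 4
card-power-bound {C₁} {q} {s} (c , (r , 0≤r , r<c , 2≤r⁴) , c<C₁)
  (p , (_ , b , _ , d , (_ , C₁<b , _ , (u , 0≤u , u<d , q⁷≤u⁴)) , (_ , _ , _ , bd<p)) , p<s) =
  fromℕ-cancel-≤ (begin
    fromℕ (q ^ 7)   ≤⟨ q⁷≤u⁴ ⟩
    u ⁴             <⟨ ⁴-mono-< 0≤u u<s ⟩
    fromℕ s ⁴       ≡⟨ fromℕ-⁴ s ⟩
    fromℕ (s ^ 4)   ∎)
  where
  open ℚ.≤-Reasoning
  1≤b : 1ℚ ℚ.≤ b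
  1≤b = ℚ.≤-trans (2≤r⁴⇒1≤r 0≤r 2≤r⁴) (ℚ.<⇒≤ (ℚ.<-trans r<c (ℝ.L<U C₁ c<C₁ C₁<b)))
  u<s : u ℚ.< fromℕ s
  u<s = begin-strict
    u           <⟨ u<d ⟩
    d           ≡⟨ ℚ.*-identityˡ d ⟨
    1ℚ ℚ.* d    ≤⟨ ℚ.*-monoʳ-≤-nonNeg d {{ℚ.nonNegative (ℚ.<⇒≤ (ℚ.≤-<-trans 0≤u u<d))}} 1≤b ⟩
    b ℚ.* d     <⟨ bd<p ⟩
    p           <⟨ p<s ⟩
    fromℕ s     ∎

⅒ : ℚ
⅒ = ℤ.+ 1 ℚ./ 10

-- Both factors are rational, so a rational below their interval product lies below the actual
-- product m / 10, by `bilinear-lower`.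
≥ʳ-⅒ : ∀ {m n} → m ℕ.≤ 10 ℕ.* n → natʳ n ≥ʳ ratʳ ⅒ *ʳ natʳ m
≥ʳ-⅒ {m} {n} m≤10n p (a , b , c , d , (a<⅒ , ⅒<b , c<m , m<d) , below) = begin-strict
  p                                <⟨ bilinear-lower (ℚ.<⇒≤ a<⅒) (ℚ.<⇒≤ ⅒<b) (ℚ.<⇒≤ c<m) (ℚ.<⇒≤ m<d) below ⟩
  ⅒ ℚ.* fromℕ m                    ≤⟨ ℚ.*-monoˡ-≤-nonNeg ⅒ (fromℕ-mono-≤ m≤10n) ⟩
  ⅒ ℚ.* fromℕ (10 ℕ.* n)           ≡⟨ cong (⅒ ℚ.*_) (fromℕ-* 10 n) ⟩
  -- After reassociation, `⅒ ℚ.* fromℕ 10` evaluates to `1ℚ`.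
  ⅒ ℚ.* (fromℕ 10 ℚ.* fromℕ n)     ≡⟨ ℚ.*-assoc ⅒ (fromℕ 10) (fromℕ n) ⟨
  1ℚ ℚ.* fromℕ n                   ≡⟨ ℚ.*-identityˡ (fromℕ n) ⟩
  fromℕ n                          ∎
  where open ℚ.≤-Reasoning

theorem1p1 : (C₁ : ℝ) → C₁ >ʳ ∜ 2 →
    ∃[ C₂ ] (C₂ >ʳ natʳ 0 ×
    (∀ (q : ℕ) .{{_ : NonZero q}} → Prime q → q % 4 ≡ 3 →
    (E : Pred (Point q) 0ℓ) (E? : Decidable E) →
    natʳ (card E?) >ʳ C₁ *ʳ ∜ (q ^ 7) →
    natʳ (card-T₂ E?) ≥ʳ C₂ *ʳ natʳ (q ^ 3)))
theorem1p1 C₁ C₁>∜2 = ratʳ ⅒ , 0<⅒ , λ q q-prime q%4≡3 E E? large →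
  ≥ʳ-⅒ {q ^ 3} {card-T₂ E?} (q³≤10*card-T₂ q q-prime q%4≡3 E?
    (card-power-bound {C₁} {q} {card E?} C₁>∜2 large))
  where
  0<⅒ : ratʳ ⅒ >ʳ natʳ 0
  0<⅒ = let (p , 0<p , p<⅒) = ℚ.<-dense (ℚ.positive⁻¹ ⅒) in p , 0<p , p<⅒
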